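{- Let $K=\mathbb Q(\sqrt d)$ be a quadratic field with $d\in\{ -1,-2,-3,-7,-11\}$, and let $O_K$ be the ring of algebraic integers in $K$. Let $\pi$ be any irreducible element of $O_K$, and let $k$ be a positive integer with $\gcd(k,N(\pi)-1)>1$, where $N(\pi)=\pi\bar\pi$ is the norm of $\pi$ with respect to $K/\mathbb Q$. Then there exists a $k$th power non-residue $\omega\in O_K$ modulo $\pi$ with $|\omega|<\sqrt{|\pi|}+0.65$.
   Context: For $\alpha\in O_K$ not divisible by $\pi$, $\alpha$ is a $k$th power residue modulo $\pi$ if the congruence $x^k\equiv \alpha \pmod{\pi}$ has a solution $x\in O_K$, and a $k$th power non-residue modulo $\pi$ otherwise. Here $|\cdot|$ denotes the complex absolute value. -}

module Defs where

open import Data.Integer using (ℤ; +_; -[1+_]; _+_; _*_; -_; _-_; ∣_∣)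
open import Data.Nat using (ℕ; zero; suc)
open import Data.Product using (∃; _×_)
open import Data.Sum using (_⊎_)
open import Relation.Binary.PropositionalEquality using (_≡_)
open import Relation.Nullary using (¬_)
import Data.Rational as Q

data Field : Set where
  d-1 d-2 d-3 d-7 d-11 : Field

dOf : Field → ℤ
dOf d-1  = -[1+ 0 ]
dOf d-2  = -[1+ 1 ]
dOf d-3  = -[1+ 2 ]
dOf d-7  = -[1+ 6 ]
dOf d-11 = -[1+ 10 ]

-- O_K = ℤ[θ] with θ = √d if d ≢ 1 (mod 4), θ = (1 + √d)/2 if d ≡ 1 (mod 4).
-- θ satisfies θ² = tr·θ + nn.
tr : Field → ℤ
tr d-1  = + 0
tr d-2  = + 0
tr d-3  = + 1
tr d-7  = + 1
tr d-11 = + 1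

nn : Field → ℤ
nn d-1  = -[1+ 0 ]
nn d-2  = -[1+ 1 ]
nn d-3  = -[1+ 0 ]
nn d-7  = -[1+ 1 ]
nn d-11 = -[1+ 2 ]

record O (F : Field) : Set where
  constructor _⊕_θ
  field
    re : ℤ
    im : ℤ
open O public

module _ {F : Field} where
  infixl 6 _+O_ _-O_
  infixl 7 _*O_

  _+O_ : O F → O F → O F
  (a ⊕ b θ) +O (c ⊕ e θ) = (a + c) ⊕ (b + e) θ

  -O_ : O F → O F
  -O (a ⊕ b θ) = (- a) ⊕ (- b) θ

  _-O_ : O F → O F → O F
  x -O y = x +O (-O y)

  _*O_ : O F → O F → O F
  (a ⊕ b θ) *O (c ⊕ e θ) = (a * c + b * e * nn F) ⊕ (a * e + b * c + b * e * tr F) θ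

  0O 1O : O F
  0O = (+ 0) ⊕ (+ 0) θ
  1O = (+ 1) ⊕ (+ 0) θ

  _^O_ : O F → ℕ → O F
  x ^O zero = 1O
  x ^O suc k = x *O (x ^O k)

  -- field norm N(a + bθ) = (a + bθ)(a + bθ̄) = a² + tr·ab - nn·b²
  N : O F → ℤ
  N (a ⊕ b θ) = a * a + tr F * a * b - nn F * b * b

  _∣O_ : O F → O F → Set
  x ∣O y = ∃ λ q → y ≡ q *O x

  IsUnit : O F → Set
  IsUnit u = ∃ λ v → u *O v ≡ 1O

  Irreducible : O F → Set
  Irreducible p = ¬ (p ≡ 0O) × ¬ IsUnit p ×
    (∀ a b → p ≡ a *O b → IsUnit a ⊎ IsUnit b)

  Cong : O F → O F → O F → Set
  Cong π x y = π ∣O (x -O y)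

  NonResidue : ℕ → O F → O F → Set
  NonResidue k π α = ¬ (π ∣O α) × ¬ (∃ λ x → Cong π (x ^O k) α)

  -- |ω| < √|π| + 0.65, where |ω| = √N(ω), |π| = N(π)^{1/2}, so
  -- √|π| = N(π)^{1/4}. Expressed without reals: there is a rational
  -- b ≥ 0 with b < N(π)^{1/4} (i.e. b⁴ < N(π)) and √N(ω) < b + 0.65
  -- (i.e. N(ω) < (b + 0.65)²).
  AbsBound : O F → O F → Set
  AbsBound ω π = ∃ λ (b : Q.ℚ) →
    (Q.0ℚ Q.≤ b) × (b Q.* b Q.* b Q.* b Q.< (N π Q./ 1)) ×
    ((N ω Q./ 1) Q.< (b Q.+ c) Q.* (b Q.+ c))
    where c = (+ 65) Q./ 100

{-# OPTIONS --safe #-}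
module Submission where

-- Let ω be a k-th power non-residue with N(ω) < N(π) and write π = γ ω + ρ with N(ρ) < N(ω), which is
-- possible because O_K is norm-Euclidean. If -1, ρ and γ were all k-th powers modulo π, so would be ω,
-- since γ ω ≡ -ρ. So -1 is a non-residue, or there is one of smaller norm than ω, or
-- |ω| ≤ |γ|, and then |ω|² ≤ |γ ω| ≤ |π| + |ω|, which gives |ω| < √|π| + 0.65. Descending on the norm
-- proves the theorem once some non-residue exists; it does because otherwise, with g = gcd(k, N(π) - 1),
-- all N(π) - 1 units of the field O_K/π would be roots of X^((N(π) - 1)/g) - 1.

open import Algebra.Bundles using (AbelianGroup; CommutativeRing)
open import Algebra.Properties.Group using (∙-cancelˡ)
open import Data.Fin.Base using (Fin; toℕ; fromℕ<)
import Data.Fin.Properties as Fin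
open import Data.List.Base using (List; []; _∷_; length; map; foldr; filter; _++_; allFin; cartesianProductWith)
open import Data.List.Properties using (length-map; length-++; length-tabulate)
import Data.List.Membership.Propositional.Properties as ∈ₚ
import Data.List.Membership.Setoid as Membership
import Data.List.Membership.Setoid.Properties as Membershipₚ
import Data.List.Relation.Binary.Permutation.Setoid as Permutation
import Data.List.Relation.Binary.Permutation.Setoid.Properties as Permutationₚ
open import Data.List.Relation.Unary.All as All using (All; []; _∷_)
import Data.List.Relation.Unary.All.Properties as Allₚ
open import Data.List.Relation.Unary.AllPairs using ([]; _∷_)
open import Data.List.Relation.Unary.Any as Any using (Any; here; there)
import Data.List.Relation.Unary.Unique.Propositional.Properties as Unique-≡
import Data.List.Relation.Unary.Unique.Setoid as Unique
import Data.List.Relation.Unary.Unique.Setoid.Properties as Uniqueₚ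
open import Data.Nat.Base as ℕ using (ℕ; zero; suc; z≤n; s≤s)
import Data.Nat.Divisibility as ℕ
open import Data.Nat.GCD using (gcd; gcd[m,n]∣m; gcd[m,n]∣n)
import Data.Nat.GCD as ℕ
open import Data.Nat.Induction using (<-wellFounded)
import Data.Nat.Properties as ℕ
import Data.Nat.Tactic.RingSolver as ℕSolver
open import Data.Product.Base using (∃; ∃₂; _×_; _,_; proj₁; proj₂)
open import Data.Sum.Base using (_⊎_; inj₁; inj₂; reduce)
open import Data.Vec.Base using (Vec; []; _∷_; replicate)
open import Function.Base using (_∘_; it)
open import Induction.WellFounded using (Acc; acc)
open import Level using (0ℓ; _⊔_)
open import Relation.Binary.Bundles using (Setoid)
open import Relation.Binary.Definitions using (Decidable)
open import Relation.Binary.PropositionalEquality as ≡ using (_≡_)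
open import Relation.Nullary using (¬_; Dec; yes; no; contradiction; ¬?)
open import Relation.Nullary.Decidable using (map′; _×-dec_)

-- Origin of 0.65: given |ω|² < |π| + |ω|, it suffices that (|ω| - 0.65)² ≤ |ω|² - |ω|, that is 0.3
-- |ω| ≥ 0.4225, which among nonzero ω fails only for norm 1. Since `AbsBound` asks for a rational
-- below the fourth root of N(π), some slack must remain for rounding; norms up to 2 are therefore
-- settled apart, with 1 as that rational. All estimates compare integer norms, and square roots are
-- removed by squaring. Division with remainder serves twice: besides driving the descent, it
-- inverts x modulo π, because x either divides π, and is then a unit by irreducibility, or leaves a
-- smaller nonzero remainder to invert. The residue classes are listed explicitly. The list has N(π)
-- entries, which links the gcd hypothesis to the field, and searching it decides whether an element
-- is a k-th power, so the case distinctions of the descent are constructive.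

module _ {a ℓ} (S : Setoid a ℓ) where
  open Setoid S
  open Membership S using (_∈_)
  open Permutation S using (_↭_; ↭-refl; ↭-sym; ↭-trans; ↭-reflexive-≋; prep)
  open Unique S using (Unique)

  -- The head of `xs` is located in `ys`, moved to the front and struck off both lists; by
  -- uniqueness the remaining lists still have the same members. This serves to count the units and
  -- to see that multiplication by a unit permutes them.
  Unique∧⊆∧⊇⇒↭ : ∀ {xs ys} → Unique xs → Unique ys →
    (∀ {z} → z ∈ xs → z ∈ ys) → (∀ {z} → z ∈ ys → z ∈ xs) → xs ↭ ys
  Unique∧⊆∧⊇⇒↭ {[]} {[]} _ _ _ _ = ↭-refl
  Unique∧⊆∧⊇⇒↭ {[]} {y ∷ ys} _ _ _ ⊇ with () ← ⊇ (here refl)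
  Unique∧⊆∧⊇⇒↭ {x ∷ xs} {ys} (x∉xs ∷ xs!) ys! ⊆ ⊇
    with as , bs , w , x≈w , eq ← Membershipₚ.∈-∃++ S (⊆ (here refl)) =
    ↭-trans (prep x≈w (Unique∧⊆∧⊇⇒↭ xs! rest! ⊆′ ⊇′)) (↭-sym ys↭)
    where
    ys↭ : ys ↭ w ∷ as ++ bs
    ys↭ = ↭-trans (↭-reflexive-≋ eq) (Permutationₚ.shift S refl as bs)
    w∷rest! : Unique (w ∷ as ++ bs)
    w∷rest! = Permutationₚ.Unique-resp-↭ S ys↭ ys!
    rest! : Unique (as ++ bs)
    rest! with _ ∷ u ← w∷rest! = u
    ≉∈ : ∀ {u v zs} → All (λ z → ¬ u ≈ z) zs → v ∈ zs → ¬ u ≈ v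
    ≉∈ u∉ v∈ u≈v = Allₚ.All¬⇒¬Any u∉ (Any.map (trans u≈v) v∈)
    ⊆′ : ∀ {z} → z ∈ xs → z ∈ as ++ bs
    ⊆′ z∈ with Permutationₚ.∈-resp-↭ S ys↭ (⊆ (there z∈))
    ... | here z≈w = contradiction (trans x≈w (sym z≈w)) (≉∈ x∉xs z∈)
    ... | there z∈′ = z∈′
    ⊇′ : ∀ {z} → z ∈ as ++ bs → z ∈ xs
    ⊇′ z∈ with ⊇ (Permutationₚ.∈-resp-↭ S (↭-sym ys↭) (there z∈)) | w∷rest!
    ... | here z≈x | w∉ ∷ _ = contradiction (trans (sym x≈w) (sym z≈x)) (≉∈ w∉ z∈)
    ... | there z∈′ | _ = z∈′

-- Powers in a finite field

module _ {c ℓ} (R : CommutativeRing c ℓ) where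
  open CommutativeRing R
  open Membership setoid using (_∈_; find)
  open Unique setoid using (Unique)

  module FiniteField (_≟_ : Decidable _≈_) (1≉0 : ¬ 1# ≈ 0#)
    (inverse : ∀ x → ¬ x ≈ 0# → ∃ λ y → y * x ≈ 1#)
    (elems : List Carrier) (elems! : Unique elems) (∈-elems : ∀ x → x ∈ elems) where

    open import Algebra.Properties.Group +-group using () renaming (x∙y⁻¹≈ε⇒x≈y to x-y≈0⇒x≈y)
    open import Algebra.Properties.AbelianGroup +-abelianGroup using (xyx⁻¹≈y)
    open import Algebra.Properties.Semiring.Exp semiring
    open import Algebra.Properties.CommutativeSemiring.Exp commutativeSemiring using (^-distrib-*)
    open Permutation setoid using (_↭_)
    open import Relation.Binary.Reasoning.Setoid setoid
    open import Algebra.Solver.Ring.NaturalCoefficients.Default commutativeSemiring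
      using (solve; _:=_; _:+_; _:*_)

    *-cancelˡ-≉0 : ∀ {x y z} → ¬ x ≈ 0# → x * y ≈ x * z → y ≈ z
    *-cancelˡ-≉0 {x} {y} {z} x≉0 xy≈xz with w , wx≈1 ← inverse x x≉0 = begin
      y            ≈⟨ *-identityˡ y ⟨
      1# * y       ≈⟨ *-congʳ wx≈1 ⟨
      w * x * y    ≈⟨ *-assoc w x y ⟩
      w * (x * y)  ≈⟨ *-congˡ xy≈xz ⟩
      w * (x * z)  ≈⟨ *-assoc w x z ⟨
      w * x * z    ≈⟨ *-congʳ wx≈1 ⟩
      1# * z       ≈⟨ *-identityˡ z ⟩
      z            ∎

    *-≉0 : ∀ {x y} → ¬ x ≈ 0# → ¬ y ≈ 0# → ¬ x * y ≈ 0#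
    *-≉0 x≉0 y≉0 xy≈0 = y≉0 (*-cancelˡ-≉0 x≉0 (trans xy≈0 (sym (zeroʳ _))))

    0^ : ∀ {x n} → n ℕ.> 0 → x ≈ 0# → x ^ n ≈ 0#
    0^ {n = suc n} _ x≈0 = trans (*-congʳ x≈0) (zeroˡ _)

    IsPower : ℕ → Carrier → Set _
    IsPower k x = ∃ λ y → y ^ k ≈ x

    -- Exhaustive search for a root in `elems`; the descent branches on this decision.
    isPower? : ∀ k x → Dec (IsPower k x)
    isPower? k x = map′ Any.satisfied
      (λ (y , yᵏ≈x) → Any.map (λ y≈z → trans (^-congˡ k (sym y≈z)) yᵏ≈x) (∈-elems y))
      (Any.any? (λ y → (y ^ k) ≟ x) elems)

    IsPower-resp-≈ : ∀ {k x y} → x ≈ y → IsPower k x → IsPower k y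
    IsPower-resp-≈ x≈y (s , sᵏ≈x) = s , trans sᵏ≈x x≈y

    IsPower-* : ∀ {k x y} → IsPower k x → IsPower k y → IsPower k (x * y)
    IsPower-* {k} (s , sᵏ≈x) (t , tᵏ≈y) = s * t , trans (^-distrib-* s t k) (*-cong sᵏ≈x tᵏ≈y)

    -- The root is s / t. For k > 0, t ≈ 0 would force y ≈ 0, so t is invertible.
    IsPower-cancelʳ : ∀ {k x y} → k ℕ.> 0 → ¬ y ≈ 0# → IsPower k (x * y) → IsPower k y → IsPower k x
    IsPower-cancelʳ {k} {x} {y} k>0 y≉0 (s , sᵏ≈xy) (t , tᵏ≈y)
      with u , ut≈1 ← inverse t (λ t≈0 → y≉0 (trans (sym tᵏ≈y) (0^ k>0 t≈0))) =
      u * s , *-cancelˡ-≉0 y≉0 (begin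
        y * (u * s) ^ k        ≈⟨ *-congʳ tᵏ≈y ⟨
        t ^ k * (u * s) ^ k    ≈⟨ ^-distrib-* t (u * s) k ⟨
        (t * (u * s)) ^ k      ≈⟨ ^-congˡ k (solve 3 (λ t u s → t :* (u :* s) := (u :* t) :* s) refl t u s) ⟩
        (u * t * s) ^ k        ≈⟨ ^-congˡ k (trans (*-congʳ ut≈1) (*-identityˡ s)) ⟩
        s ^ k                  ≈⟨ sᵏ≈xy ⟩
        x * y                  ≈⟨ *-comm x y ⟩
        y * x                  ∎)

    -- The vector c₀ … c_{d-1} stands for the monic polynomial X^d + c_{d-1} X^(d-1) + … + c₀.
    eval : ∀ {d} → Vec Carrier d → Carrier → Carrier
    eval []       x = 1#
    eval (c ∷ cs) x = c + x * eval cs x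

    -- Horner's scheme for (p - p(a)) / (X - a): its coefficients are the values at a of the
    -- successive tails of p, and the leading 1 stays implicit.
    quotient : ∀ {d} → Vec Carrier (suc d) → Carrier → Vec Carrier d
    quotient (_ ∷ [])         a = []
    quotient (_ ∷ p@(_ ∷ _))  a = eval p a ∷ quotient p a

    -- With w standing for x - a, only semiring identities are needed.
    eval-quotient : ∀ {d} (p : Vec Carrier (suc d)) a w →
      eval p (a + w) ≈ eval p a + w * eval (quotient p a) (a + w)
    eval-quotient (c ∷ []) a w =
      solve 4 (λ c a w i → c :+ (a :+ w) :* i := (c :+ a :* i) :+ w :* i) refl c a w 1#
    eval-quotient (c ∷ p@(_ ∷ _)) a w = begin
      c + (a + w) * eval p (a + w)
        ≈⟨ +-congˡ (*-congˡ (eval-quotient p a w)) ⟩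
      c + (a + w) * (eval p a + w * eval (quotient p a) (a + w))
        ≈⟨ solve 5 (λ c a w e q → c :+ (a :+ w) :* (e :+ w :* q) :=
             (c :+ a :* e) :+ w :* (e :+ (a :+ w) :* q)) refl c a w (eval p a) (eval (quotient p a) (a + w)) ⟩
      (c + a * eval p a) + w * (eval p a + (a + w) * eval (quotient p a) (a + w)) ∎

    eval-cong : ∀ {d} (p : Vec Carrier d) {x y} → x ≈ y → eval p x ≈ eval p y
    eval-cong []      _   = refl
    eval-cong (c ∷ p) x≈y = +-congˡ (*-cong x≈y (eval-cong p x≈y))

    -- Dividing by X - a lowers the degree by one, and the other roots remain roots of the quotient
    -- because x - a ≉ 0 can be cancelled. In degree 0 the polynomial is the constant 1, which has
    -- no root.
    roots≤degree : ∀ {d} (p : Vec Carrier d) {xs} → Unique xs →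
      All (λ x → eval p x ≈ 0#) xs → length xs ℕ.≤ d
    roots≤degree p {[]} _ _ = z≤n
    roots≤degree [] {x ∷ xs} _ (1≈0 ∷ _) = contradiction 1≈0 1≉0
    roots≤degree {suc d} p {a ∷ xs} (a∉xs ∷ xs!) (pa≈0 ∷ pxs≈0) =
      s≤s (roots≤degree (quotient p a) xs! (All.zipWith root (a∉xs , pxs≈0)))
      where
      root : ∀ {x} → ¬ a ≈ x × eval p x ≈ 0# → eval (quotient p a) x ≈ 0#
      root {x} (a≉x , px≈0) = *-cancelˡ-≉0 {x - a} (a≉x ∘ sym ∘ x-y≈0⇒x≈y _ _) (begin
        (x - a) * eval (quotient p a) x                   ≈⟨ *-congˡ (eval-cong (quotient p a) a+[x-a]≈x) ⟨
        (x - a) * eval (quotient p a) (a + (x - a))       ≈⟨ +-identityˡ _ ⟨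
        0# + (x - a) * eval (quotient p a) (a + (x - a))  ≈⟨ +-congʳ pa≈0 ⟨
        eval p a + (x - a) * eval (quotient p a) (a + (x - a))
                                                          ≈⟨ eval-quotient p a (x - a) ⟨
        eval p (a + (x - a))                              ≈⟨ eval-cong p a+[x-a]≈x ⟩
        eval p x                                          ≈⟨ px≈0 ⟩
        0#                                                ≈⟨ zeroʳ _ ⟨
        (x - a) * 0#                                      ∎)
        where
        a+[x-a]≈x : a + (x - a) ≈ x
        a+[x-a]≈x = trans (sym (+-assoc a x (- a))) (xyx⁻¹≈y a x)

    eval-replicate-0 : ∀ d x → eval (replicate d 0#) x ≈ x ^ d
    eval-replicate-0 zero    x = refl
    eval-replicate-0 (suc d) x = trans (+-identityˡ _) (*-congˡ (eval-replicate-0 d x))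

    roots-of-unity≤ : ∀ m → m ℕ.> 0 → ∀ {xs} → Unique xs → All (λ x → x ^ m ≈ 1#) xs → length xs ℕ.≤ m
    roots-of-unity≤ (suc m) _ xs! xsᵐ≈1 = roots≤degree (- 1# ∷ replicate m 0#) xs!
      (All.map (λ {x} xᵐ≈1 → begin
        - 1# + x * eval (replicate m 0#) x  ≈⟨ +-congˡ (*-congˡ (eval-replicate-0 m x)) ⟩
        - 1# + x ^ suc m                    ≈⟨ +-congˡ xᵐ≈1 ⟩
        - 1# + 1#                           ≈⟨ -‿inverseˡ 1# ⟩
        0#                                  ∎) xsᵐ≈1)

    nonzero? : ∀ x → Dec (¬ x ≈ 0#)
    nonzero? x = ¬? (x ≟ 0#)

    ≉0-resp : ∀ {x y} → x ≈ y → ¬ x ≈ 0# → ¬ y ≈ 0#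
    ≉0-resp x≈y x≉0 y≈0 = x≉0 (trans x≈y y≈0)

    units : List Carrier
    units = filter nonzero? elems

    units! : Unique units
    units! = Uniqueₚ.filter⁺ setoid nonzero? elems!

    ∈-units⁺ : ∀ {x} → ¬ x ≈ 0# → x ∈ units
    ∈-units⁺ x≉0 = Membershipₚ.∈-filter⁺ setoid nonzero? ≉0-resp (∈-elems _) x≉0

    ∈-units⁻ : ∀ {x} → x ∈ units → ¬ x ≈ 0#
    ∈-units⁻ x∈ = proj₂ (Membershipₚ.∈-filter⁻ setoid nonzero? ≉0-resp {xs = elems} x∈)

    units≉0 : All (λ x → ¬ x ≈ 0#) units
    units≉0 = Allₚ.all-filter nonzero? elems

    suc-length-units : suc (length units) ≡ length elems
    suc-length-units = Permutationₚ.xs↭ys⇒|xs|≡|ys| setoid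
      (Unique∧⊆∧⊇⇒↭ setoid (All.map (_∘ sym) units≉0 ∷ units!) elems! (λ _ → ∈-elems _) 0∷units⊇)
      where
      0∷units⊇ : ∀ {z} → z ∈ elems → z ∈ 0# ∷ units
      0∷units⊇ {z} _ with z ≟ 0#
      ... | yes z≈0 = here z≈0
      ... | no  z≉0 = there (∈-units⁺ z≉0)

    product : List Carrier → Carrier
    product = foldr _*_ 1#

    product-map-* : ∀ x ys → product (map (x *_) ys) ≈ product ys * x ^ length ys
    product-map-* x []       = sym (*-identityˡ 1#)
    product-map-* x (y ∷ ys) = trans (*-congˡ (product-map-* x ys))
      (solve 4 (λ x y p e → (x :* y) :* (p :* e) := (y :* p) :* (x :* e)) refl x y (product ys) (x ^ length ys))

    product-≉0 : ∀ {xs} → All (λ x → ¬ x ≈ 0#) xs → ¬ product xs ≈ 0#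
    product-≉0 []            = 1≉0
    product-≉0 (x≉0 ∷ xs≉0)  = *-≉0 x≉0 (product-≉0 xs≉0)

    -- Multiplication by x permutes the units, so their product P satisfies P ≈ P * x ^ length units.
    fermat : ∀ {x} → ¬ x ≈ 0# → x ^ length units ≈ 1#
    fermat {x} x≉0 = *-cancelˡ-≉0 (product-≉0 units≉0) (begin
      product units * x ^ length units  ≈⟨ product-map-* x units ⟨
      product (map (x *_) units)
        ≈⟨ Permutationₚ.foldr-commMonoid setoid *-isCommutativeMonoid permuted ⟩
      product units                     ≈⟨ *-identityʳ _ ⟨
      product units * 1#                ∎)
      where
      ⊆ : ∀ {z} → z ∈ map (x *_) units → z ∈ units
      ⊆ z∈ with y , y∈ , z≈xy ← Membershipₚ.∈-map⁻ setoid setoid z∈ =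
        ∈-units⁺ (≉0-resp (sym z≈xy) (*-≉0 x≉0 (∈-units⁻ y∈)))
      ⊇ : ∀ {z} → z ∈ units → z ∈ map (x *_) units
      ⊇ {z} z∈ with w , wx≈1 ← inverse x x≉0 =
        Membershipₚ.∈-resp-≈ setoid (sym z≈xwz)
          (Membershipₚ.∈-map⁺ setoid setoid *-congˡ
            (∈-units⁺ (λ wz≈0 → ∈-units⁻ z∈ (trans z≈xwz (trans (*-congˡ wz≈0) (zeroʳ x))))))
        where
        z≈xwz : z ≈ x * (w * z)
        z≈xwz = begin
          z            ≈⟨ *-identityˡ z ⟨
          1# * z       ≈⟨ *-congʳ wx≈1 ⟨
          w * x * z    ≈⟨ solve 3 (λ w x z → w :* x :* z := x :* (w :* z)) refl w x z ⟩
          x * (w * z)  ∎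
      permuted : map (x *_) units ↭ units
      permuted = Unique∧⊆∧⊇⇒↭ setoid (Uniqueₚ.map⁺ setoid setoid (*-cancelˡ-≉0 x≉0) units!) units! ⊆ ⊇

    -- With g = gcd k (q - 1) and q - 1 = m g, if all units were k-th powers
    -- then all q - 1 of them would be roots of X ^ m - 1, although m < q - 1.
    ∃-nonPower : ∀ k → k ℕ.> 0 → gcd k (length elems ℕ.∸ 1) ℕ.> 1 →
      ∃ λ x → ¬ x ≈ 0# × ¬ IsPower k x
    ∃-nonPower k k>0 1<gcd with All.all? (isPower? k) units
    ... | no ¬all = let x , x∈ , x∉ = find (Allₚ.¬All⇒Any¬ (isPower? k) units ¬all) in x , ∈-units⁻ x∈ , x∉
    ... | yes all = contradiction (roots-of-unity≤ m m>0 units! (All.zipWith (λ (p , x≉0) → root p x≉0) (all , units≉0)))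
                      (ℕ.<⇒≱ m<)
      where
      q = length units
      q≡ : length elems ℕ.∸ 1 ≡ q
      q≡ = ≡.cong ℕ.pred (≡.sym suc-length-units)
      g = gcd k q
      1<g : 1 ℕ.< g
      1<g = ≡.subst (λ q → gcd k q ℕ.> 1) q≡ 1<gcd
      open ℕ._∣_ (gcd[m,n]∣n k q) renaming (quotient to m; equality to q≡mg)
      open ℕ._∣_ (gcd[m,n]∣m k q) renaming (quotient to l; equality to k≡lg)
      q>0 : q ℕ.> 0
      q>0 with units | ∈-units⁺ 1≉0
      ... | _ ∷ _ | _ = s≤s z≤n
      m>0 : m ℕ.> 0
      m>0 = ℕ.n≢0⇒n>0 (λ m≡0 → ℕ.>⇒≢ q>0 (≡.trans q≡mg (≡.cong (ℕ._* g) m≡0)))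
      m< : m ℕ.< q
      m< = ≡.subst (m ℕ.<_) (≡.sym q≡mg) (ℕ.m<m*n m g {{ℕ.>-nonZero m>0}} 1<g)
      -- From k = l g and q = m g follows k m = q l, so x ^ m = y ^ (k m) is a power of y ^ q, which
      -- is 1.
      root : ∀ {x} → IsPower k x → ¬ x ≈ 0# → x ^ m ≈ 1#
      root {x} (y , yᵏ≈x) x≉0 = begin
        x ^ m                    ≈⟨ ^-congˡ m yᵏ≈x ⟨
        (y ^ k) ^ m              ≈⟨ ^-assocʳ y k m ⟩
        y ^ (k ℕ.* m)            ≡⟨ ≡.cong (y ^_) exponents ⟩
        y ^ (q ℕ.* l)            ≈⟨ ^-assocʳ y q l ⟨
        (y ^ q) ^ l              ≈⟨ ^-congˡ l (fermat (λ y≈0 → x≉0 (trans (sym yᵏ≈x) (0^ k>0 y≈0)))) ⟩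
        1# ^ l                   ≈⟨ 1^ l ⟩
        1#                       ∎
        where
        exponents : k ℕ.* m ≡ q ℕ.* l
        exponents = ≡.trans (≡.cong (ℕ._* m) k≡lg) (≡.trans (lemma l g m) (≡.cong (ℕ._* l) (≡.sym q≡mg)))
          where
          lemma : ∀ l g m → l ℕ.* g ℕ.* m ≡ m ℕ.* g ℕ.* l
          lemma = ℕSolver.solve-∀
        1^ : ∀ n → 1# ^ n ≈ 1#
        1^ zero = refl
        1^ (suc n) = trans (*-identityˡ _) (1^ n)

-- The quotient of a commutative ring by a principal ideal

module Quotient {c ℓ} (R : CommutativeRing c ℓ) (π : CommutativeRing.Carrier R) where
  open CommutativeRing R
  open import Algebra.Properties.Ring ring using (-‿distribˡ-*)
  open import Algebra.Properties.AbelianGroup +-abelianGroup using (⁻¹-∙-comm)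
  open import Relation.Binary.Reasoning.Setoid setoid
  open import Algebra.Solver.Ring.NaturalCoefficients.Default commutativeSemiring
    using (solve; _:=_; _:+_; _:*_)

  infix 4 _≈π_

  -- Subtraction-free, so that the ring laws below reduce to semiring identities.
  record _≈π_ (x y : Carrier) : Set (c ⊔ ℓ) where
    constructor _by_
    field
      multiple : Carrier
      ≈+*π     : x ≈ y + multiple * π
  open _≈π_ public

  ≈⇒≈π : ∀ {x y} → x ≈ y → x ≈π y
  ≈⇒≈π {x} {y} x≈y = 0# by trans x≈y (sym (trans (+-congˡ (zeroˡ π)) (+-identityʳ y)))

  ≈π-sym : ∀ {x y} → x ≈π y → y ≈π x
  ≈π-sym {x} {y} (q by x≈) = (- q) by sym (begin
    x + - q * π              ≈⟨ +-congʳ x≈ ⟩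
    y + q * π + - q * π      ≈⟨ solve 4 (λ y q r π → y :+ q :* π :+ r :* π := y :+ (q :+ r) :* π) refl y q (- q) π ⟩
    y + (q + - q) * π        ≈⟨ +-congˡ (trans (*-congʳ (-‿inverseʳ q)) (zeroˡ π)) ⟩
    y + 0#                   ≈⟨ +-identityʳ y ⟩
    y                        ∎)

  ≈π-trans : ∀ {x y z} → x ≈π y → y ≈π z → x ≈π z
  ≈π-trans {x} {y} {z} (q by x≈) (r by y≈) = (r + q) by (begin
    x                     ≈⟨ x≈ ⟩
    y + q * π             ≈⟨ +-congʳ y≈ ⟩
    z + r * π + q * π     ≈⟨ solve 4 (λ z q r π → z :+ r :* π :+ q :* π := z :+ (r :+ q) :* π) refl z q r π ⟩
    z + (r + q) * π       ∎)

  +-≈π : ∀ {x y u v} → x ≈π y → u ≈π v → x + u ≈π y + v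
  +-≈π {y = y} {v = v} (q by x≈) (r by u≈) = (q + r) by trans (+-cong x≈ u≈)
    (solve 5 (λ y v q r π → y :+ q :* π :+ (v :+ r :* π) := y :+ v :+ (q :+ r) :* π) refl y v q r π)

  *-≈π : ∀ {x y u v} → x ≈π y → u ≈π v → x * u ≈π y * v
  *-≈π {y = y} {v = v} (q by x≈) (r by u≈) = (q * v + y * r + q * π * r) by trans (*-cong x≈ u≈)
    (solve 5 (λ y v q r π → (y :+ q :* π) :* (v :+ r :* π) := y :* v :+ (q :* v :+ y :* r :+ q :* π :* r) :* π)
      refl y v q r π)

  neg-≈π : ∀ {x y} → x ≈π y → - x ≈π - y
  neg-≈π {x} {y} (q by x≈) = (- q) by (begin
    - x                ≈⟨ -‿cong x≈ ⟩
    - (y + q * π)      ≈⟨ ⁻¹-∙-comm y (q * π) ⟨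
    - y + - (q * π)    ≈⟨ +-congˡ (-‿distribˡ-* q π) ⟩
    - y + - q * π      ∎)

  quotientRing : CommutativeRing c (c ⊔ ℓ)
  quotientRing = record
    { _≈_ = _≈π_ ; _+_ = _+_ ; _*_ = _*_ ; -_ = -_ ; 0# = 0# ; 1# = 1#
    ; isCommutativeRing = record
      { isRing = record
        { +-isAbelianGroup = record
          { isGroup = record
            { isMonoid = record
              { isSemigroup = record
                { isMagma = record
                  { isEquivalence = record { refl = ≈⇒≈π refl ; sym = ≈π-sym ; trans = ≈π-trans }
                  ; ∙-cong = +-≈π }
                ; assoc = λ x y z → ≈⇒≈π (+-assoc x y z) }
              ; identity = (λ x → ≈⇒≈π (+-identityˡ x)) , (λ x → ≈⇒≈π (+-identityʳ x)) }
            ; inverse = (λ x → ≈⇒≈π (-‿inverseˡ x)) , (λ x → ≈⇒≈π (-‿inverseʳ x))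
            ; ⁻¹-cong = neg-≈π }
          ; comm = λ x y → ≈⇒≈π (+-comm x y) }
        ; *-cong = *-≈π
        ; *-assoc = λ x y z → ≈⇒≈π (*-assoc x y z)
        ; *-identity = (λ x → ≈⇒≈π (*-identityˡ x)) , (λ x → ≈⇒≈π (*-identityʳ x))
        ; distrib = (λ x y z → ≈⇒≈π (distribˡ x y z)) , (λ x y z → ≈⇒≈π (distribʳ x y z)) }
      ; *-comm = λ x y → ≈⇒≈π (*-comm x y) } }

open import Defs
open import Data.Nat.Base using (_<_; _>_)
open import Data.Integer using (ℤ; +_; -[1+_]; _+_; _*_; -_; _-_; ∣_∣)
import Data.Integer.Base as ℤ
import Data.Integer.Divisibility.Signed as ℤ
open import Data.Integer.DivMod as ℤ using (_/ℕ_; _%ℕ_)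
import Data.Integer.Properties as ℤ
open import Data.Integer.Tactic.RingSolver using (solve-∀)
import Data.Rational.Base as ℚ
import Data.Rational.Properties as ℚ
open import Data.Rational.Unnormalised.Base as ℚᵘ using (mkℚᵘ; *<*; *≤*)
import Data.Rational.Unnormalised.Properties as ℚᵘ
open import Relation.Binary.PropositionalEquality using (refl; cong; cong₂; sym; trans; subst; subst₂)

-- The ring structure of O_K

module _ {F : Field} where

  private
    t n : ℤ
    t = tr F
    n = nn F

  +O-assoc : ∀ (x y z : O F) → (x +O y) +O z ≡ x +O (y +O z)
  +O-assoc (a ⊕ b θ) (c ⊕ d θ) (e ⊕ f θ) = cong₂ _⊕_θ (ℤ.+-assoc a c e) (ℤ.+-assoc b d f)

  +O-comm : ∀ (x y : O F) → x +O y ≡ y +O x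
  +O-comm (a ⊕ b θ) (c ⊕ d θ) = cong₂ _⊕_θ (ℤ.+-comm a c) (ℤ.+-comm b d)

  +O-identityˡ : ∀ (x : O F) → 0O +O x ≡ x
  +O-identityˡ (a ⊕ b θ) = cong₂ _⊕_θ (ℤ.+-identityˡ a) (ℤ.+-identityˡ b)

  -O-inverseˡ : ∀ (x : O F) → (-O x) +O x ≡ 0O
  -O-inverseˡ (a ⊕ b θ) = cong₂ _⊕_θ (ℤ.+-inverseˡ a) (ℤ.+-inverseˡ b)

  *O-assoc : ∀ (x y z : O F) → (x *O y) *O z ≡ x *O (y *O z)
  *O-assoc (a ⊕ b θ) (c ⊕ d θ) (e ⊕ f θ) = cong₂ _⊕_θ (re-eq a b c d e f t n) (im-eq a b c d e f t n)
    where
    re-eq : ∀ a b c d e f t n → (a * c + b * d * n) * e + (a * d + b * c + b * d * t) * f * n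
      ≡ a * (c * e + d * f * n) + b * (c * f + d * e + d * f * t) * n
    re-eq = solve-∀
    im-eq : ∀ a b c d e f t n →
      (a * c + b * d * n) * f + (a * d + b * c + b * d * t) * e + (a * d + b * c + b * d * t) * f * t
      ≡ a * (c * f + d * e + d * f * t) + b * (c * e + d * f * n) + b * (c * f + d * e + d * f * t) * t
    im-eq = solve-∀

  *O-comm : ∀ (x y : O F) → x *O y ≡ y *O x
  *O-comm (a ⊕ b θ) (c ⊕ d θ) = cong₂ _⊕_θ (re-eq a b c d n) (im-eq a b c d t)
    where
    re-eq : ∀ a b c d n → a * c + b * d * n ≡ c * a + d * b * n
    re-eq = solve-∀
    im-eq : ∀ a b c d t → a * d + b * c + b * d * t ≡ c * b + d * a + d * b * t
    im-eq = solve-∀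

  *O-identityˡ : ∀ (x : O F) → 1O *O x ≡ x
  *O-identityˡ (a ⊕ b θ) = cong₂ _⊕_θ (re-eq a b n) (im-eq a b t)
    where
    re-eq : ∀ a b n → + 1 * a + + 0 * b * n ≡ a
    re-eq = solve-∀
    im-eq : ∀ a b t → + 1 * b + + 0 * a + + 0 * b * t ≡ b
    im-eq = solve-∀

  *O-distribˡ-+O : ∀ (x y z : O F) → x *O (y +O z) ≡ x *O y +O x *O z
  *O-distribˡ-+O (a ⊕ b θ) (c ⊕ d θ) (e ⊕ f θ) = cong₂ _⊕_θ (re-eq a b c d e f n) (im-eq a b c d e f t)
    where
    re-eq : ∀ a b c d e f n → a * (c + e) + b * (d + f) * n ≡ a * c + b * d * n + (a * e + b * f * n)
    re-eq = solve-∀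
    im-eq : ∀ a b c d e f t → a * (d + f) + b * (c + e) + b * (d + f) * t
      ≡ a * d + b * c + b * d * t + (a * f + b * e + b * f * t)
    im-eq = solve-∀

module _ (F : Field) where
  open import Algebra.Consequences.Propositional {A = O F}
    using (comm∧idˡ⇒id; comm∧invˡ⇒inv; comm∧distrˡ⇒distrʳ)

  ringO : CommutativeRing 0ℓ 0ℓ
  ringO = record
    { Carrier = O F ; _≈_ = _≡_ ; _+_ = _+O_ ; _*_ = _*O_ ; -_ = λ x → -O x ; 0# = 0O ; 1# = 1O
    ; isCommutativeRing = record
      { isRing = record
        { +-isAbelianGroup = record
          { isGroup = record
            { isMonoid = record
              { isSemigroup = record
                { isMagma = ≡.isMagma _+O_
                ; assoc = +O-assoc }
              ; identity = comm∧idˡ⇒id +O-comm +O-identityˡ }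
            ; inverse = comm∧invˡ⇒inv +O-comm -O-inverseˡ
            ; ⁻¹-cong = cong (λ x → -O x) }
          ; comm = +O-comm }
        ; *-cong = cong₂ _*O_
        ; *-assoc = *O-assoc
        ; *-identity = comm∧idˡ⇒id *O-comm *O-identityˡ
        ; distrib = *O-distribˡ-+O , comm∧distrˡ⇒distrʳ {_*O_} {_+O_} *O-comm *O-distribˡ-+O }
      ; *-comm = *O-comm } }

-- Norm, conjugation and division with remainder

module _ {F : Field} where

  private
    t n : ℤ
    t = tr F
    n = nn F

  N-* : ∀ (x y : O F) → N (x *O y) ≡ N x * N y
  N-* (a ⊕ b θ) (c ⊕ d θ) = eq a b c d t n
    where
    eq : ∀ a b c d t n →
      (a * c + b * d * n) * (a * c + b * d * n) + t * (a * c + b * d * n) * (a * d + b * c + b * d * t)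
        - n * (a * d + b * c + b * d * t) * (a * d + b * c + b * d * t)
      ≡ (a * a + t * a * b - n * b * b) * (c * c + t * c * d - n * d * d)
    eq = solve-∀

  N-neg : ∀ (x : O F) → N (-O x) ≡ N x
  N-neg (a ⊕ b θ) = eq a b t n
    where
    eq : ∀ a b t n → (- a) * (- a) + t * (- a) * (- b) - n * (- b) * (- b) ≡ a * a + t * a * b - n * b * b
    eq = solve-∀

  -- The roots of X² - t X - n have sum t, so θ is sent to t - θ.
  conj : O F → O F
  conj (a ⊕ b θ) = (a + t * b) ⊕ (- b) θ

  *-conj : ∀ (x : O F) → x *O conj x ≡ N x ⊕ + 0 θ
  *-conj (a ⊕ b θ) = cong₂ _⊕_θ (re-eq a b t n) (im-eq a b t)
    where
    re-eq : ∀ a b t n → a * (a + t * b) + b * (- b) * n ≡ a * a + t * a * b - n * b * b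
    re-eq = solve-∀
    im-eq : ∀ a b t → a * (- b) + b * (a + t * b) + b * (- b) * t ≡ + 0
    im-eq = solve-∀

  N-conj : ∀ x → N (conj x) ≡ N x
  N-conj (a ⊕ b θ) = eq a b t n
    where
    eq : ∀ a b t n → (a + t * b) * (a + t * b) + t * (a + t * b) * (- b) - n * (- b) * (- b) ≡ a * a + t * a * b - n * b * b
    eq = solve-∀

-- Absolute value of the discriminant t² + 4n of X² - t X - n, which is negative for all five
-- fields.
disc : (F : Field) → ℕ
disc F = ∣ tr F * tr F + + 4 * nn F ∣

+disc : ∀ F → + disc F ≡ - (tr F * tr F + + 4 * nn F)
+disc d-1 = refl
+disc d-2 = refl
+disc d-3 = refl
+disc d-7 = refl
+disc d-11 = refl

disc>0 : ∀ F → disc F ℕ.> 0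
disc>0 d-1 = s≤s z≤n
disc>0 d-2 = s≤s z≤n
disc>0 d-3 = s≤s z≤n
disc>0 d-7 = s≤s z≤n
disc>0 d-11 = s≤s z≤n

-- This is what makes the fields norm-Euclidean: rounding a quotient leaves an error of norm at most
-- 1/4 + `disc F`/16, which is then at most 15/16.
disc<12 : ∀ F → disc F ℕ.< 12
disc<12 d-1 = ℕ.m≤m+n 5 7
disc<12 d-2 = ℕ.m≤m+n 9 3
disc<12 d-3 = ℕ.m≤m+n 4 8
disc<12 d-7 = ℕ.m≤m+n 8 4
disc<12 d-11 = ℕ.m≤m+n 12 0

sq : ∀ i → i * i ≡ + (∣ i ∣ ℕ.* ∣ i ∣)
sq (+ m) = sym (ℤ.pos-* m m)
sq -[1+ m ] = refl

i≤+∣i∣ : ∀ i → i ℤ.≤ + ∣ i ∣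
i≤+∣i∣ (+ m) = ℤ.≤-refl
i≤+∣i∣ -[1+ m ] = ℤ.-≤+

0≤sq : ∀ i → + 0 ℤ.≤ i * i
0≤sq i = subst (+ 0 ℤ.≤_) (sym (sq i)) (ℤ.+≤+ z≤n)

0≤*sq : ∀ m i → + 0 ℤ.≤ + m * (i * i)
0≤*sq m i = subst (+ 0 ℤ.≤_) (trans (ℤ.pos-* m _) (cong (+ m *_) (sym (sq i)))) (ℤ.+≤+ z≤n)

module _ {F : Field} where

  private
    t n : ℤ
    t = tr F
    n = nn F

  -- Completing the square exhibits the norm as a positive definite form. Positivity, definiteness
  -- and the bound on remainders all come from it.
  4N : ∀ (a b : ℤ) → + 4 * N {F} (a ⊕ b θ) ≡ (+ 2 * a + t * b) * (+ 2 * a + t * b) + + disc F * (b * b)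
  4N a b = trans (eq a b t n)
    (cong (λ δ → (+ 2 * a + t * b) * (+ 2 * a + t * b) + δ * (b * b)) (sym (+disc F)))
    where
    eq : ∀ a b t n → + 4 * (a * a + t * a * b - n * b * b) ≡
      (+ 2 * a + t * b) * (+ 2 * a + t * b) + - (t * t + + 4 * n) * (b * b)
    eq = solve-∀

  -- The norm as a natural number: the square of the complex absolute value, and multiplicative.
  ∥_∥ : O F → ℕ
  ∥ x ∥ = ∣ N x ∣

  0≤N : ∀ (x : O F) → + 0 ℤ.≤ N x
  0≤N x@(a ⊕ b θ) = ℤ.*-cancelˡ-≤-pos (+ 0) (N x) (+ 4) (subst (+ 0 ℤ.≤_) (sym (4N a b))
    (ℤ.+-mono-≤ (0≤sq (+ 2 * a + t * b)) (0≤*sq (disc F) b)))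

  +∥∥ : ∀ (x : O F) → + ∥ x ∥ ≡ N x
  +∥∥ x = ℤ.0≤i⇒+∣i∣≡i (0≤N x)

  ∥∥-* : ∀ (x y : O F) → ∥ x *O y ∥ ≡ ∥ x ∥ ℕ.* ∥ y ∥
  ∥∥-* x y = trans (cong ∣_∣ (N-* x y)) (ℤ.abs-* (N x) (N y))

  4∥∥ : ∀ a b → 4 ℕ.* ∥ a ⊕ b θ ∥ ≡
    ∣ + 2 * a + t * b ∣ ℕ.* ∣ + 2 * a + t * b ∣ ℕ.+ disc F ℕ.* (∣ b ∣ ℕ.* ∣ b ∣)
  4∥∥ a b = ℤ.+-injective (trans (ℤ.pos-* 4 ∥ a ⊕ b θ ∥) (trans (cong (+ 4 *_) (+∥∥ (a ⊕ b θ))) (trans (4N a b)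
    (cong₂ _+_ (sq (+ 2 * a + t * b)) (trans (cong (+ disc F *_) (sq b)) (sym (ℤ.pos-* (disc F) _)))))))

  ∥∥≡0 : ∀ {x : O F} → ∥ x ∥ ≡ 0 → x ≡ 0O
  ∥∥≡0 {a ⊕ b θ} N≡0 = cong₂ _⊕_θ a≡0 b≡0
    where
    sq≡0 : ∀ i → ∣ i ∣ ℕ.* ∣ i ∣ ≡ 0 → i ≡ + 0
    sq≡0 i i²≡0 = ℤ.∣i∣≡0⇒i≡0 (reduce (ℕ.m*n≡0⇒m≡0∨n≡0 ∣ i ∣ i²≡0))
    sum≡0 = trans (sym (4∥∥ a b)) (cong (4 ℕ.*_) N≡0)
    b≡0 : b ≡ + 0
    b≡0 with ℕ.m*n≡0⇒m≡0∨n≡0 (disc F) (ℕ.m+n≡0⇒n≡0 (∣ + 2 * a + t * b ∣ ℕ.* ∣ + 2 * a + t * b ∣) sum≡0)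
    ... | inj₁ disc≡0 = contradiction disc≡0 (ℕ.>⇒≢ (disc>0 F))
    ... | inj₂ b²≡0 = sq≡0 b b²≡0
    2a≡0 : + 2 * a ≡ + 0
    2a≡0 = let open ≡.≡-Reasoning in begin
      + 2 * a            ≡⟨ ℤ.+-identityʳ _ ⟨
      + 2 * a + + 0      ≡⟨ cong (_+_ (+ 2 * a)) (ℤ.*-zeroʳ t) ⟨
      + 2 * a + t * + 0  ≡⟨ cong (λ b → + 2 * a + t * b) b≡0 ⟨
      + 2 * a + t * b    ≡⟨ sq≡0 _ (ℕ.m+n≡0⇒m≡0 _ sum≡0) ⟩
      + 0                ∎
    a≡0 : a ≡ + 0
    a≡0 = ℤ.*-cancelˡ-≡ (+ 2) a (+ 0) 2a≡0

  ∥∥>0 : ∀ {x} → ¬ x ≡ 0O → ∥ x ∥ ℕ.> 0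
  ∥∥>0 x≢0 = ℕ.n≢0⇒n>0 (λ eq → x≢0 (∥∥≡0 eq))

  ∥∥≡1⇒unit : ∀ (x : O F) → ∥ x ∥ ≡ 1 → IsUnit x
  ∥∥≡1⇒unit x N≡1 = conj x , trans (*-conj x) (cong (_⊕ + 0 θ) (trans (sym (+∥∥ x)) (cong +_ N≡1)))

  unit⇒∥∥≡1 : ∀ (x : O F) → IsUnit x → ∥ x ∥ ≡ 1
  unit⇒∥∥≡1 x (y , xy≡1) = ℕ.m*n≡1⇒m≡1 ∥ x ∥ ∥ y ∥ (trans (sym (∥∥-* x y)) (trans (cong ∥_∥ xy≡1) ∥1∥))
    where
    ∥1∥ : ∥ 1O ∥ ≡ 1
    ∥1∥ = ℤ.+-injective (trans (+∥∥ 1O) (eq t n))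
      where
      eq : ∀ t n → + 1 * + 1 + t * + 1 * + 0 - n * + 0 * + 0 ≡ + 1
      eq = solve-∀

  -- Polarisation: p is |Tr(x ȳ)|, and the bound is the Cauchy–Schwarz inequality.
  ∥∥-+ : ∀ (x y : O F) → ∃ λ p → ∥ x +O y ∥ ℕ.≤ ∥ x ∥ ℕ.+ ∥ y ∥ ℕ.+ p × p ℕ.* p ℕ.≤ 4 ℕ.* (∥ x ∥ ℕ.* ∥ y ∥)
  ∥∥-+ x@(a ⊕ b θ) y@(c ⊕ d θ) = ∣ T ∣ ,
    ℤ.drop‿+≤+ (begin
      + ∥ x +O y ∥                 ≡⟨ +∥∥ (x +O y) ⟩
      N (x +O y)                   ≡⟨ polar a b c d t n ⟩
      N x + N y + T                ≤⟨ ℤ.+-monoʳ-≤ (N x + N y) (i≤+∣i∣ T) ⟩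
      N x + N y + + ∣ T ∣          ≡⟨ cong₂ (λ u v → u + v + + ∣ T ∣) (+∥∥ x) (+∥∥ y) ⟨
      + (∥ x ∥ ℕ.+ ∥ y ∥ ℕ.+ ∣ T ∣) ∎) ,
    ℤ.drop‿+≤+ (begin
      + (∣ T ∣ ℕ.* ∣ T ∣)          ≡⟨ sq T ⟨
      T * T                        ≡⟨ ℤ.+-identityʳ _ ⟨
      T * T + + 0                  ≤⟨ ℤ.+-monoʳ-≤ (T * T) (0≤*sq (disc F) D) ⟩
      T * T + + disc F * (D * D)   ≡⟨ cong (λ δ → T * T + δ * (D * D)) (+disc F) ⟩
      T * T + - (t * t + + 4 * n) * (D * D) ≡⟨ gap a b c d t n ⟩
      + 4 * (N x * N y)            ≡⟨ cong₂ (λ u v → + 4 * (u * v)) (+∥∥ x) (+∥∥ y) ⟨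
      + 4 * (+ ∥ x ∥ * + ∥ y ∥)    ≡⟨ cong (+ 4 *_) (ℤ.pos-* ∥ x ∥ ∥ y ∥) ⟨
      + 4 * + (∥ x ∥ ℕ.* ∥ y ∥)    ≡⟨ ℤ.pos-* 4 (∥ x ∥ ℕ.* ∥ y ∥) ⟨
      + (4 ℕ.* (∥ x ∥ ℕ.* ∥ y ∥))  ∎)
    where
    open ℤ.≤-Reasoning
    T D : ℤ
    T = + 2 * a * c + t * (a * d + b * c) - + 2 * n * b * d
    -- `T` is the trace of x ȳ and `D` is minus its θ-coordinate, so completing the square for x ȳ
    -- gives 4 N(x) N(y) = T² + `disc F` D².
    D = a * d - b * c
    polar : ∀ a b c d t n → (a + c) * (a + c) + t * (a + c) * (b + d) - n * (b + d) * (b + d)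
      ≡ a * a + t * a * b - n * b * b + (c * c + t * c * d - n * d * d)
        + (+ 2 * a * c + t * (a * d + b * c) - + 2 * n * b * d)
    polar = solve-∀
    gap : ∀ a b c d t n →
      (+ 2 * a * c + t * (a * d + b * c) - + 2 * n * b * d) * (+ 2 * a * c + t * (a * d + b * c) - + 2 * n * b * d)
        + - (t * t + + 4 * n) * ((a * d - b * c) * (a * d - b * c))
      ≡ + 4 * ((a * a + t * a * b - n * b * b) * (c * c + t * c * d - n * d * d))
    gap = solve-∀

  private
    -- Nearest integer to m / 2M: adding M before the floor division turns the remainder r, with 0 ≤
    -- r < 2M, into the error r - M.
    round : ∀ m (M : ℕ) → M ℕ.> 0 → ∃ λ q → ∣ m - + 2 * + M * q ∣ ℕ.≤ M
    round m M M>0 = q , (begin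
      ∣ m - + 2 * + M * q ∣    ≡⟨ cong ∣_∣ (eq m (+ M) (+ r) q split) ⟩
      ∣ + r - + M ∣            ≤⟨ ∣r-M∣≤M ⟩
      M                        ∎)
      where
      open ℕ.≤-Reasoning
      instance
        2M≢0 : ℕ.NonZero (2 ℕ.* M)
        2M≢0 = ℕ.m*n≢0 2 M {{it}} {{ℕ.>-nonZero M>0}}
      q = (m + + M) /ℕ (2 ℕ.* M)
      r = (m + + M) %ℕ (2 ℕ.* M)
      split : m + + M ≡ + r + q * (+ 2 * + M)
      split = trans (ℤ.a≡a%ℕn+[a/ℕn]*n (m + + M) (2 ℕ.* M)) (cong (λ z → + r + q * z) (ℤ.pos-* 2 M))
      eq : ∀ m M r q → m + M ≡ r + q * (+ 2 * M) → m - + 2 * M * q ≡ r - M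
      eq m M r q h = trans (l₁ m M q) (trans (cong (λ z → z - M - + 2 * M * q) h) (l₂ M r q))
        where
        l₁ : ∀ m M q → m - + 2 * M * q ≡ m + M - M - + 2 * M * q
        l₁ = solve-∀
        l₂ : ∀ M r q → r + q * (+ 2 * M) - M - + 2 * M * q ≡ r - M
        l₂ = solve-∀
      ∣r-M∣≤M : ∣ + r - + M ∣ ℕ.≤ M
      ∣r-M∣≤M with ℕ.≤-total r M
      ... | inj₁ r≤M = subst (ℕ._≤ M) (sym (trans (cong ∣_∣ (ℤ.[+m]-[+n]≡m⊖n r M)) (ℤ.∣⊖∣-≤ r≤M))) (ℕ.m∸n≤m M r)
      ... | inj₂ M≤r = subst (ℕ._≤ M)
        (sym (trans (cong ∣_∣ (ℤ.[+m]-[+n]≡m⊖n r M)) (trans (ℤ.∣m⊖n∣≡∣n⊖m∣ r M) (ℤ.∣⊖∣-≤ M≤r))))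
        (ℕ.m≤n+o⇒m∸n≤o r M (ℕ.≤-trans (ℕ.<⇒≤ (ℤ.n%ℕd<d (m + + M) (2 ℕ.* M))) (ℕ.≤-reflexive (cong (M ℕ.+_) (ℕ.+-identityʳ M)))))

  -- The θ-coordinate is rounded first, so that the rounding of 2a + tr b can use its remainder.
  euclid : ∀ x {y} → ¬ y ≡ 0O → ∃₂ λ q r → x ≡ q *O y +O r × ∥ r ∥ ℕ.< ∥ y ∥
  euclid x {y} y≢0 = q , r , x≡qy+r , ∥r∥<∥y∥
    where
    M = ∥ y ∥
    -- x / y = x ȳ / N(y), so A / M and B / M are the coordinates to be rounded.
    A = re (x *O conj y)
    B = im (x *O conj y)
    round-im = round (+ 2 * B) M (∥∥>0 y≢0)
    q₁ = proj₁ round-im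
    w = B - + M * q₁
    round-re = round (+ 2 * A + t * w) M (∥∥>0 y≢0)
    q₀ = proj₁ round-re
    u = A - + M * q₀
    q r : O F
    q = q₀ ⊕ q₁ θ
    r = x -O q *O y
    open import Algebra.Properties.AbelianGroup (CommutativeRing.+-abelianGroup (ringO F)) using (xyx⁻¹≈y)
    open CommutativeRing (ringO F) using (distribʳ; +-assoc; ring)
    open import Algebra.Properties.Ring ring using (-‿distribˡ-*)
    x≡qy+r : x ≡ q *O y +O r
    x≡qy+r = trans (sym (xyx⁻¹≈y (q *O y) x)) (+-assoc (q *O y) x _)
    r*conj : r *O conj y ≡ u ⊕ w θ
    r*conj = let open ≡.≡-Reasoning in begin
      r *O conj y                                  ≡⟨ distribʳ (conj y) x (-O (q *O y)) ⟩
      x *O conj y +O (-O (q *O y)) *O conj y       ≡⟨ cong (x *O conj y +O_) (-‿distribˡ-* (q *O y) (conj y)) ⟨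
      x *O conj y -O q *O y *O conj y              ≡⟨ cong (λ z → x *O conj y -O z) (*O-assoc q y (conj y)) ⟩
      x *O conj y -O q *O (y *O conj y)            ≡⟨ cong (λ z → x *O conj y -O q *O z) (*-conj y) ⟩
      x *O conj y -O q *O (N y ⊕ + 0 θ)            ≡⟨ cong (λ z → x *O conj y -O q *O (z ⊕ + 0 θ)) (+∥∥ y) ⟨
      x *O conj y -O q *O ((+ M) ⊕ + 0 θ)          ≡⟨ cong₂ _⊕_θ (re-eq A q₀ q₁ (+ M) n) (im-eq B q₀ q₁ (+ M) t) ⟩
      u ⊕ w θ                                      ∎
      where
      re-eq : ∀ A q₀ q₁ M n → A + - (q₀ * M + q₁ * + 0 * n) ≡ A - M * q₀
      re-eq = solve-∀
      im-eq : ∀ B q₀ q₁ M t → B + - (q₀ * + 0 + q₁ * M + q₁ * + 0 * t) ≡ B - M * q₁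
      im-eq = solve-∀
    2w≤M : 2 ℕ.* ∣ w ∣ ℕ.≤ M
    2w≤M = subst (ℕ._≤ M) (trans (cong ∣_∣ (eq B (+ M) q₁)) (ℤ.abs-* (+ 2) w)) (proj₂ round-im)
      where
      eq : ∀ B M q₁ → + 2 * B - + 2 * M * q₁ ≡ + 2 * (B - M * q₁)
      eq = solve-∀
    2u+tw≤M : ∣ + 2 * u + t * w ∣ ℕ.≤ M
    2u+tw≤M = subst (ℕ._≤ M) (cong ∣_∣ (eq A (+ M) q₀ t w)) (proj₂ round-re)
      where
      eq : ∀ A M q₀ t w → + 2 * A + t * w - + 2 * M * q₀ ≡ + 2 * (A - M * q₀) + t * w
      eq = solve-∀
    -- As ȳ has norm M, the left side is 16 times the norm of r ȳ = u + w θ. The two rounding errors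
    -- |2u + tw| and |2w| are at most M, and 15 = 4 + 11, where 11 bounds `disc F`.
    16∥r∥M≤15MM : 16 ℕ.* (∥ r ∥ ℕ.* M) ℕ.≤ 15 ℕ.* (M ℕ.* M)
    16∥r∥M≤15MM = let open ℕ.≤-Reasoning in begin
      16 ℕ.* (∥ r ∥ ℕ.* M)                      ≡⟨ cong (λ z → 16 ℕ.* (∥ r ∥ ℕ.* ∣ z ∣)) (N-conj y) ⟨
      16 ℕ.* (∥ r ∥ ℕ.* ∥ conj y ∥)             ≡⟨ cong (16 ℕ.*_) (∥∥-* r (conj y)) ⟨
      16 ℕ.* ∥ r *O conj y ∥                    ≡⟨ cong (λ z → 16 ℕ.* ∥ z ∥) r*conj ⟩
      16 ℕ.* ∥ u ⊕ w θ ∥                        ≡⟨ ℕ.*-assoc 4 4 ∥ u ⊕ w θ ∥ ⟩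
      4 ℕ.* (4 ℕ.* ∥ u ⊕ w θ ∥)                 ≡⟨ cong (4 ℕ.*_) (4∥∥ u w) ⟩
      4 ℕ.* (U ℕ.* U ℕ.+ disc F ℕ.* (∣ w ∣ ℕ.* ∣ w ∣))
                                                ≡⟨ eq U (disc F) ∣ w ∣ ⟩
      4 ℕ.* (U ℕ.* U) ℕ.+ disc F ℕ.* (2 ℕ.* ∣ w ∣ ℕ.* (2 ℕ.* ∣ w ∣))
        ≤⟨ ℕ.+-mono-≤ (ℕ.*-monoʳ-≤ 4 (ℕ.*-mono-≤ 2u+tw≤M 2u+tw≤M)) (ℕ.*-mono-≤ (ℕ.s≤s⁻¹ (disc<12 F)) (ℕ.*-mono-≤ 2w≤M 2w≤M)) ⟩
      4 ℕ.* (M ℕ.* M) ℕ.+ 11 ℕ.* (M ℕ.* M)      ≡⟨ ℕ.*-distribʳ-+ (M ℕ.* M) 4 11 ⟨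
      15 ℕ.* (M ℕ.* M)                          ∎
      where
      U = ∣ + 2 * u + t * w ∣
      eq : ∀ U δ w → 4 ℕ.* (U ℕ.* U ℕ.+ δ ℕ.* (w ℕ.* w)) ≡ 4 ℕ.* (U ℕ.* U) ℕ.+ δ ℕ.* (2 ℕ.* w ℕ.* (2 ℕ.* w))
      eq = ℕSolver.solve-∀
    ∥r∥<∥y∥ : ∥ r ∥ ℕ.< M
    ∥r∥<∥y∥ = ℕ.≰⇒> λ M≤∥r∥ → ℕ.<⇒≱ (ℕ.*-monoˡ-< (M ℕ.* M) {{ℕ.m*n≢0 M M}} {15} {16} ℕ.≤-refl)
      (ℕ.≤-trans (ℕ.*-monoʳ-≤ 16 (ℕ.*-monoˡ-≤ M M≤∥r∥)) 16∥r∥M≤15MM)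
      where instance
      M≢0 : ℕ.NonZero M
      M≢0 = ℕ.>-nonZero (∥∥>0 y≢0)

-- The numerical bound

-- With b = m/40, so that b + 0.65 = (m + 26)/40.
absBound-/40 : ∀ {F} (ω π : O F) m → m ℕ.* m ℕ.* m ℕ.* m ℕ.< ∥ π ∥ ℕ.* 2560000 →
  ∥ ω ∥ ℕ.* 1600 ℕ.< (m ℕ.+ 26) ℕ.* (m ℕ.+ 26) → AbsBound ω π
absBound-/40 ω π m m⁴< <m+26 = b , 0≤b , b⁴<Nπ , Nω<
  where
  b c : ℚ.ℚ
  b = + m ℚ./ 40
  c = + 65 ℚ./ 100
  B C : ℚᵘ.ℚᵘ
  B = mkℚᵘ (+ m) 39
  C = mkℚᵘ (+ 65) 99
  b≃B : ℚ.toℚᵘ b ℚᵘ.≃ B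
  b≃B = ℚ.toℚᵘ-fromℚᵘ B
  c≃C : ℚ.toℚᵘ c ℚᵘ.≃ C
  c≃C = ℚ.toℚᵘ-fromℚᵘ C
  0≤b : ℚ.0ℚ ℚ.≤ b
  0≤b = ℚ.toℚᵘ-cancel-≤ (ℚᵘ.≤-respʳ-≃ (ℚᵘ.≃-sym b≃B) (*≤* (ℤ.≤-trans (ℤ.≤-reflexive (ℤ.*-zeroˡ (+ 40))) (subst (+ 0 ℤ.≤_) (ℤ.pos-* m 1) (ℤ.+≤+ z≤n)))))
  _⊛_ : ∀ {p q P Q} → ℚ.toℚᵘ p ℚᵘ.≃ P → ℚ.toℚᵘ q ℚᵘ.≃ Q → ℚ.toℚᵘ (p ℚ.* q) ℚᵘ.≃ P ℚᵘ.* Q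
  _⊛_ {p} {q} p≃ q≃ = ℚᵘ.≃-trans (ℚ.toℚᵘ-homo-* p q) (ℚᵘ.*-cong p≃ q≃)
  _⊞_ : ∀ {p q P Q} → ℚ.toℚᵘ p ℚᵘ.≃ P → ℚ.toℚᵘ q ℚᵘ.≃ Q → ℚ.toℚᵘ (p ℚ.+ q) ℚᵘ.≃ P ℚᵘ.+ Q
  _⊞_ {p} {q} p≃ q≃ = ℚᵘ.≃-trans (ℚ.toℚᵘ-homo-+ p q) (ℚᵘ.+-cong p≃ q≃)
  infixl 7 _⊛_
  N≃ : ∀ x → ℚ.toℚᵘ (N x ℚ./ 1) ℚᵘ.≃ mkℚᵘ (N x) 0
  N≃ x = ℚ.toℚᵘ-fromℚᵘ (mkℚᵘ (N x) 0)
  b⁴<Nπ : b ℚ.* b ℚ.* b ℚ.* b ℚ.< N π ℚ./ 1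
  b⁴<Nπ = ℚ.toℚᵘ-cancel-< (ℚᵘ.<-respˡ-≃ (ℚᵘ.≃-sym (b≃B ⊛ b≃B ⊛ b≃B ⊛ b≃B)) (ℚᵘ.<-respʳ-≃ (ℚᵘ.≃-sym (N≃ π)) (*<* <ℤ)))
    where
    lhs : + (m ℕ.* m ℕ.* m ℕ.* m) ≡ + m * + m * + m * + m * + 1
    lhs = sym (trans (ℤ.*-identityʳ _) (trans (cong (λ z → z * + m * + m) (sym (ℤ.pos-* m m))) (trans (cong (_* + m) (sym (ℤ.pos-* (m ℕ.* m) m))) (sym (ℤ.pos-* (m ℕ.* m ℕ.* m) m)))))
    <ℤ : + m * + m * + m * + m * + 1 ℤ.< N π * + 2560000
    <ℤ = subst₂ ℤ._<_ lhs (trans (ℤ.pos-* ∥ π ∥ 2560000) (cong (_* + 2560000) (+∥∥ π))) (ℤ.+<+ m⁴<)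
  Nω< : N ω ℚ./ 1 ℚ.< (b ℚ.+ c) ℚ.* (b ℚ.+ c)
  Nω< = ℚ.toℚᵘ-cancel-< (ℚᵘ.<-respˡ-≃ (ℚᵘ.≃-sym (N≃ ω)) (ℚᵘ.<-respʳ-≃ (ℚᵘ.≃-sym ((b≃B ⊞ c≃C) ⊛ (b≃B ⊞ c≃C))) (*<* <ℤ)))
    where
    -- The unreduced sum `B + C` is (100 m + 2600) / 4000, so the hypothesis with denominator 40²
    -- has to be multiplied by 100² = 10000.
    s = m ℕ.* 100 ℕ.+ 2600
    <ℕ : ∥ ω ∥ ℕ.* 16000000 ℕ.< s ℕ.* s
    <ℕ = subst₂ ℕ._<_ (ℕ.*-assoc ∥ ω ∥ 1600 10000) (eq m) (ℕ.*-monoˡ-< 10000 <m+26)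
      where
      eq : ∀ m → (m ℕ.+ 26) ℕ.* (m ℕ.+ 26) ℕ.* 10000 ≡ (m ℕ.* 100 ℕ.+ 2600) ℕ.* (m ℕ.* 100 ℕ.+ 2600)
      eq = ℕSolver.solve-∀
    +s : + s ≡ + m * + 100 + + 65 * + 40
    +s = trans (ℤ.pos-+ (m ℕ.* 100) 2600) (cong (_+ + 2600) (ℤ.pos-* m 100))
    <ℤ : N ω * + 16000000 ℤ.< (+ m * + 100 + + 65 * + 40) * (+ m * + 100 + + 65 * + 40) * + 1
    <ℤ = subst₂ ℤ._<_ (trans (ℤ.pos-* ∥ ω ∥ 16000000) (cong (_* + 16000000) (+∥∥ ω)))
      (trans (ℤ.pos-* s s) (trans (cong₂ _*_ +s +s) (sym (ℤ.*-identityʳ _)))) (ℤ.+<+ <ℕ)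

√-floor : ∀ M → ∃ λ r → r ℕ.* r ℕ.≤ M × M ℕ.< suc r ℕ.* suc r
√-floor zero = 0 , z≤n , s≤s z≤n
√-floor (suc M) with √-floor M
... | r , r²≤M , M<[1+r]² with suc r ℕ.* suc r ℕ.≤? suc M
...   | yes [1+r]²≤1+M = suc r , [1+r]²≤1+M , ℕ.≤-<-trans M<[1+r]² (ℕ.*-mono-< (ℕ.n<1+n (suc r)) (ℕ.n<1+n (suc r)))
...   | no  [1+r]²≰1+M = r , ℕ.m≤n⇒m≤1+n r²≤M , ℕ.≰⇒> [1+r]²≰1+M

²-cancel-≤ : ∀ {a b} → a ℕ.* a ℕ.≤ b ℕ.* b → a ℕ.≤ b
²-cancel-≤ a²≤b² = ℕ.≮⇒≥ λ b<a → ℕ.<⇒≱ (ℕ.*-mono-< b<a b<a) a²≤b²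

-- The hypotheses say W ≤ √n + √R, so that W - √W < √n. Since 0.65² < 0.3 √3, this exceeds (√W - 0.65)²
-- with a margin that leaves room for a multiple of 1/40 between √W - 0.65 and n^¼.
scaled-root : ∀ {W n R p} → 3 ℕ.≤ W → R ℕ.< W → W ℕ.* W ℕ.≤ n ℕ.+ R ℕ.+ p → p ℕ.* p ℕ.≤ 4 ℕ.* (n ℕ.* R) →
  ∃ λ m → m ℕ.* m ℕ.* m ℕ.* m ℕ.< n ℕ.* 2560000 × W ℕ.* 1600 ℕ.< (m ℕ.+ 26) ℕ.* (m ℕ.+ 26)
scaled-root {W} {n} {R} {p} 3≤W R<W W²≤ p²≤ = m , ℕ.≰⇒> impossible , 1600W<t²
  where
  open ℕ.≤-Reasoning
  r = proj₁ (√-floor (W ℕ.* 1600))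
  r²≤ : r ℕ.* r ℕ.≤ W ℕ.* 1600
  r²≤ = proj₁ (proj₂ (√-floor (W ℕ.* 1600)))
  <[1+r]² : W ℕ.* 1600 ℕ.< suc r ℕ.* suc r
  <[1+r]² = proj₂ (proj₂ (√-floor (W ℕ.* 1600)))
  -- 69 is the floor of 40 √3: 69² = 4761 ≤ 4800.
  69≤r : 69 ℕ.≤ r
  69≤r = ℕ.≮⇒≥ λ r<69 → ℕ.<⇒≱ <[1+r]² (begin
    suc r ℕ.* suc r  ≤⟨ ℕ.*-mono-≤ r<69 r<69 ⟩
    4761             ≤⟨ ℕ.m≤m+n 4761 39 ⟩
    3 ℕ.* 1600       ≤⟨ ℕ.*-monoˡ-≤ 1600 3≤W ⟩
    W ℕ.* 1600       ∎)
  m t v : ℕ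
  -- `r` is the floor of 40 √W, so m + 26 = r + 1 exceeds 40 √W, while m / 40 ≤ √W - 0.625 is still
  -- low enough to stay below the fourth root of n when W ≥ 3.
  m = r ℕ.∸ 25
  t = m ℕ.+ 26
  v = m ℕ.* m
  m+25≡r : m ℕ.+ 25 ≡ r
  m+25≡r = ℕ.m∸n+n≡m (ℕ.≤-trans (ℕ.m≤m+n 25 44) 69≤r)
  t≡1+r : t ≡ suc r
  t≡1+r = trans (ℕ.+-suc m 25) (cong suc m+25≡r)
  1600W<t² : W ℕ.* 1600 ℕ.< t ℕ.* t
  1600W<t² = subst (λ t → W ℕ.* 1600 ℕ.< t ℕ.* t) (sym t≡1+r) <[1+r]²
  1600R≤t² : R ℕ.* 1600 ℕ.≤ t ℕ.* t
  1600R≤t² = ℕ.≤-trans (ℕ.*-monoˡ-≤ 1600 (ℕ.<⇒≤ R<W)) (ℕ.<⇒≤ 1600W<t²)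
  -- If √n ≤ m² / 1600, then W ≤ √n + √R with √R ≤ t / 40 gives 1600 W ≤ m² + 40 (m + 26). But 1600
  -- W ≥ (m + 25)² = m² + 50 m + 625, so 10 m ≤ 415, against m ≥ 69 - 25 = 44.
  impossible : ¬ n ℕ.* 2560000 ℕ.≤ m ℕ.* m ℕ.* m ℕ.* m
  impossible n≤ = ℕ.<⇒≱ (ℕ.m≤m+n 416 24) (begin
    44 ℕ.* 10  ≤⟨ ℕ.*-monoˡ-≤ 10 (ℕ.∸-monoˡ-≤ 25 69≤r) ⟩
    m ℕ.* 10   ≤⟨ ℕ.+-cancelˡ-≤ (m ℕ.* m ℕ.+ m ℕ.* 40 ℕ.+ 625) _ _ (begin
      m ℕ.* m ℕ.+ m ℕ.* 40 ℕ.+ 625 ℕ.+ m ℕ.* 10  ≡⟨ eq₁ m ⟩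
      (m ℕ.+ 25) ℕ.* (m ℕ.+ 25)                  ≡⟨ cong₂ ℕ._*_ m+25≡r m+25≡r ⟩
      r ℕ.* r                                    ≤⟨ r²≤ ⟩
      W ℕ.* 1600                                 ≤⟨ 1600W≤v+40t ⟩
      v ℕ.+ t ℕ.* 40                             ≡⟨ eq₂ m ⟩
      m ℕ.* m ℕ.+ m ℕ.* 40 ℕ.+ 625 ℕ.+ 415       ∎) ⟩
    415        ∎)
    where
    eq₁ : ∀ m → m ℕ.* m ℕ.+ m ℕ.* 40 ℕ.+ 625 ℕ.+ m ℕ.* 10 ≡ (m ℕ.+ 25) ℕ.* (m ℕ.+ 25)
    eq₁ = ℕSolver.solve-∀
    eq₂ : ∀ m → m ℕ.* m ℕ.+ (m ℕ.+ 26) ℕ.* 40 ≡ m ℕ.* m ℕ.+ m ℕ.* 40 ℕ.+ 625 ℕ.+ 415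
    eq₂ = ℕSolver.solve-∀
    1600²n≤v² : n ℕ.* 2560000 ℕ.≤ v ℕ.* v
    1600²n≤v² = ℕ.≤-trans n≤ (ℕ.≤-reflexive (ℕ.*-assoc (m ℕ.* m) m m))
    64000p≤2vt : p ℕ.* 64000 ℕ.≤ 2 ℕ.* (v ℕ.* t)
    64000p≤2vt = ²-cancel-≤ (begin
      p ℕ.* 64000 ℕ.* (p ℕ.* 64000)              ≡⟨ eq₃ p 64000 ⟩
      p ℕ.* p ℕ.* 4096000000                     ≤⟨ ℕ.*-monoˡ-≤ 4096000000 p²≤ ⟩
      4 ℕ.* (n ℕ.* R) ℕ.* (2560000 ℕ.* 1600)     ≡⟨ eq₄ n R 2560000 1600 ⟩
      4 ℕ.* (n ℕ.* 2560000 ℕ.* (R ℕ.* 1600))     ≤⟨ ℕ.*-monoʳ-≤ 4 (ℕ.*-mono-≤ 1600²n≤v² 1600R≤t²) ⟩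
      4 ℕ.* (v ℕ.* v ℕ.* (t ℕ.* t))              ≡⟨ eq₅ v t ⟩
      2 ℕ.* (v ℕ.* t) ℕ.* (2 ℕ.* (v ℕ.* t))      ∎)
      where
      eq₃ : ∀ p q → p ℕ.* q ℕ.* (p ℕ.* q) ≡ p ℕ.* p ℕ.* (q ℕ.* q)
      eq₃ = ℕSolver.solve-∀
      eq₄ : ∀ n R a b → 4 ℕ.* (n ℕ.* R) ℕ.* (a ℕ.* b) ≡ 4 ℕ.* (n ℕ.* a ℕ.* (R ℕ.* b))
      eq₄ = ℕSolver.solve-∀
      eq₅ : ∀ v t → 4 ℕ.* (v ℕ.* v ℕ.* (t ℕ.* t)) ≡ 2 ℕ.* (v ℕ.* t) ℕ.* (2 ℕ.* (v ℕ.* t))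
      eq₅ = ℕSolver.solve-∀
    1600W≤v+40t : W ℕ.* 1600 ℕ.≤ v ℕ.+ t ℕ.* 40
    1600W≤v+40t = ²-cancel-≤ (begin
      W ℕ.* 1600 ℕ.* (W ℕ.* 1600)                ≡⟨ eq₆ W 1600 ⟩
      W ℕ.* W ℕ.* 2560000                        ≤⟨ ℕ.*-monoˡ-≤ 2560000 W²≤ ⟩
      (n ℕ.+ R ℕ.+ p) ℕ.* 2560000                ≡⟨ eq₇ n R p 2560000 ⟩
      n ℕ.* 2560000 ℕ.+ R ℕ.* (1600 ℕ.* 1600) ℕ.+ p ℕ.* (40 ℕ.* 64000)
                                                 ≡⟨ eq₈ (n ℕ.* 2560000) R p 1600 40 64000 ⟩
      n ℕ.* 2560000 ℕ.+ R ℕ.* 1600 ℕ.* 1600 ℕ.+ p ℕ.* 64000 ℕ.* 40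
        ≤⟨ ℕ.+-mono-≤ (ℕ.+-mono-≤ 1600²n≤v² (ℕ.*-monoˡ-≤ 1600 1600R≤t²)) (ℕ.*-monoˡ-≤ 40 64000p≤2vt) ⟩
      v ℕ.* v ℕ.+ t ℕ.* t ℕ.* 1600 ℕ.+ 2 ℕ.* (v ℕ.* t) ℕ.* 40
                                                 ≡⟨ eq₉ v t 40 ⟩
      (v ℕ.+ t ℕ.* 40) ℕ.* (v ℕ.+ t ℕ.* 40)      ∎)
      where
      eq₆ : ∀ W a → W ℕ.* a ℕ.* (W ℕ.* a) ≡ W ℕ.* W ℕ.* (a ℕ.* a)
      eq₆ = ℕSolver.solve-∀
      eq₇ : ∀ n R p a → (n ℕ.+ R ℕ.+ p) ℕ.* a ≡ n ℕ.* a ℕ.+ R ℕ.* a ℕ.+ p ℕ.* a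
      eq₇ = ℕSolver.solve-∀
      eq₈ : ∀ n R p a b c → n ℕ.+ R ℕ.* (a ℕ.* a) ℕ.+ p ℕ.* (b ℕ.* c) ≡ n ℕ.+ R ℕ.* a ℕ.* a ℕ.+ p ℕ.* c ℕ.* b
      eq₈ = ℕSolver.solve-∀
      eq₉ : ∀ v t a → v ℕ.* v ℕ.+ t ℕ.* t ℕ.* (a ℕ.* a) ℕ.+ 2 ℕ.* (v ℕ.* t) ℕ.* a ≡ (v ℕ.+ t ℕ.* a) ℕ.* (v ℕ.+ t ℕ.* a)
      eq₉ = ℕSolver.solve-∀

-- Here b = 40/40 = 1 works, as 1 < 2 ≤ N(π) and 2 < 1.65².
absBound-small : ∀ {F} (ω π : O F) → 2 ℕ.≤ ∥ π ∥ → ∥ ω ∥ ℕ.≤ 2 → AbsBound ω π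
absBound-small ω π 2≤n W≤2 = absBound-/40 ω π 40
  (ℕ.<-≤-trans (ℕ.m<m+n 2560000 {2560000} (s≤s z≤n)) (ℕ.*-monoˡ-≤ 2560000 2≤n))
  (ℕ.≤-<-trans (ℕ.*-monoˡ-≤ 1600 W≤2) (ℕ.m≤m+n 3201 1155))

-- If π = ω γ + ρ, then |ω|² ≤ |ω| |γ| = |π - ρ| ≤ |π| + |ρ| < |π| + |ω|.
absBound : ∀ {F} (ω π γ ρ : O F) → 2 ℕ.≤ ∥ π ∥ → π ≡ γ *O ω +O ρ → ∥ ρ ∥ ℕ.< ∥ ω ∥ → ∥ ω ∥ ℕ.≤ ∥ γ ∥ → AbsBound ω π
absBound {F} ω π γ ρ 2≤n π≡ ρ<ω ω≤γ = by-cases (∥ ω ∥ ℕ.≤? 2)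
  where
  open CommutativeRing (ringO F) using (-‿inverseʳ; +-identityʳ)
  p = proj₁ (∥∥-+ π (-O ρ))
  N≤ : ∥ π -O ρ ∥ ℕ.≤ ∥ π ∥ ℕ.+ ∥ -O ρ ∥ ℕ.+ p
  N≤ = proj₁ (proj₂ (∥∥-+ π (-O ρ)))
  p²≤ : p ℕ.* p ℕ.≤ 4 ℕ.* (∥ π ∥ ℕ.* ∥ -O ρ ∥)
  p²≤ = proj₂ (proj₂ (∥∥-+ π (-O ρ)))
  ∥-ρ∥ : ∥ -O ρ ∥ ≡ ∥ ρ ∥
  ∥-ρ∥ = cong ∣_∣ (N-neg ρ)
  γω≡π-ρ : γ *O ω ≡ π -O ρ
  γω≡π-ρ = sym (trans (cong (_+O (-O ρ)) π≡) (trans (+O-assoc (γ *O ω) ρ (-O ρ)) (trans (cong (γ *O ω +O_) (-‿inverseʳ ρ)) (+-identityʳ (γ *O ω)))))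
  W²≤ : ∥ ω ∥ ℕ.* ∥ ω ∥ ℕ.≤ ∥ π ∥ ℕ.+ ∥ ρ ∥ ℕ.+ p
  W²≤ = begin
    ∥ ω ∥ ℕ.* ∥ ω ∥              ≤⟨ ℕ.*-monoˡ-≤ ∥ ω ∥ ω≤γ ⟩
    ∥ γ ∥ ℕ.* ∥ ω ∥              ≡⟨ ∥∥-* γ ω ⟨
    ∥ γ *O ω ∥                   ≡⟨ cong ∥_∥ γω≡π-ρ ⟩
    ∥ π -O ρ ∥                   ≤⟨ N≤ ⟩
    ∥ π ∥ ℕ.+ ∥ -O ρ ∥ ℕ.+ p     ≡⟨ cong (λ R → ∥ π ∥ ℕ.+ R ℕ.+ p) ∥-ρ∥ ⟩
    ∥ π ∥ ℕ.+ ∥ ρ ∥ ℕ.+ p        ∎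
    where open ℕ.≤-Reasoning
  p²≤′ : p ℕ.* p ℕ.≤ 4 ℕ.* (∥ π ∥ ℕ.* ∥ ρ ∥)
  p²≤′ = subst (λ R → p ℕ.* p ℕ.≤ 4 ℕ.* (∥ π ∥ ℕ.* R)) ∥-ρ∥ p²≤
  by-cases : Dec (∥ ω ∥ ℕ.≤ 2) → AbsBound ω π
  by-cases (yes W≤2) = absBound-small ω π 2≤n W≤2
  by-cases (no  W≰2) = let m , m⁴< , <[m+26]² = scaled-root {∥ ω ∥} {∥ π ∥} {∥ ρ ∥} {p} (ℕ.≰⇒> W≰2) ρ<ω W²≤ p²≤′
                       in absBound-/40 ω π m m⁴< <[m+26]²

-- Residue classes modulo π

length-cartesianProductWith : ∀ {a b c} {A : Set a} {B : Set b} {C : Set c} (f : A → B → C) xs ys →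
  length (cartesianProductWith f xs ys) ≡ length xs ℕ.* length ys
length-cartesianProductWith f []       ys = refl
length-cartesianProductWith f (x ∷ xs) ys = trans (length-++ (map (f x) ys))
  (cong₂ ℕ._+_ (length-map (f x) ys) (length-cartesianProductWith f xs ys))

∣i∣≡s*i : ∀ i → ∃ λ s → + ∣ i ∣ ≡ s * i
∣i∣≡s*i (+ n)    = + 1 , sym (ℤ.*-identityˡ (+ n))
∣i∣≡s*i -[1+ n ] = -[1+ 0 ] , sym (ℤ.-1*i≡-i -[1+ n ])

-- For π = a + b θ the cofactors show that g divides every θ-coordinate of a multiple of π, and the
-- coefficients u, w produce a multiple whose θ-coordinate is exactly g.
record Bézout (a b : ℤ) : Set where
  field
    g           : ℕ
    a′ b′ u w   : ℤ
    a≡a′g       : a ≡ a′ * + g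
    b≡b′g       : b ≡ b′ * + g
    ua+wb≡g     : u * a + w * b ≡ + g

bézout : ∀ a b → Bézout a b
bézout a b with ℕ.Bézout.lemma ∣ a ∣ ∣ b ∣
... | ℕ.Bézout.result g isGCD identity = record
  { g = g
  ; a′ = ℤ._∣_.quotient g∣a
  ; b′ = ℤ._∣_.quotient g∣b
  ; u = proj₁ (combination identity)
  ; w = proj₁ (proj₂ (combination identity))
  ; a≡a′g = ℤ._∣_.equality g∣a
  ; b≡b′g = ℤ._∣_.equality g∣b
  ; ua+wb≡g = proj₂ (proj₂ (combination identity)) }
  where
  g∣a : + g ℤ.∣ a
  g∣a = ℤ.∣ᵤ⇒∣ (ℕ.GCD.gcd∣m isGCD)
  g∣b : + g ℤ.∣ b
  g∣b = ℤ.∣ᵤ⇒∣ (ℕ.GCD.gcd∣n isGCD)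
  ∣a∣ = ∣i∣≡s*i a
  ∣b∣ = ∣i∣≡s*i b
  solved : ∀ d x y m n → + d + y * n ≡ x * m → + d ≡ x * m - y * n
  solved d x y m n eq = trans (l₁ (+ d) (y * n)) (cong (_- y * n) eq)
    where
    l₁ : ∀ d z → d ≡ d + z - z
    l₁ = solve-∀
  pos : ∀ x y m n d → d ℕ.+ y ℕ.* n ≡ x ℕ.* m → + d ≡ + x * + m - + y * + n
  pos x y m n d eq = solved d (+ x) (+ y) (+ m) (+ n)
    (trans (cong (_+_ (+ d)) (sym (ℤ.pos-* y n))) (trans (cong +_ eq) (ℤ.pos-* x m)))
  combination : ℕ.Bézout.Identity g ∣ a ∣ ∣ b ∣ → ∃₂ λ u w → u * a + w * b ≡ + g
  combination (ℕ.Bézout.+- x y eq) = + x * proj₁ ∣a∣ , - (+ y * proj₁ ∣b∣) , sym (trans (pos x y ∣ a ∣ ∣ b ∣ g eq)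
          (trans (cong₂ (λ p q → + x * p - + y * q) (proj₂ ∣a∣) (proj₂ ∣b∣)) (l (+ x) (+ y) (proj₁ ∣a∣) (proj₁ ∣b∣) a b)))
    where
    l : ∀ x y s r a b → x * (s * a) - y * (r * b) ≡ x * s * a + - (y * r) * b
    l = solve-∀
  combination (ℕ.Bézout.-+ x y eq) = - (+ x * proj₁ ∣a∣) , + y * proj₁ ∣b∣ , sym (trans (pos y x ∣ b ∣ ∣ a ∣ g eq)
          (trans (cong₂ (λ p q → + y * p - + x * q) (proj₂ ∣b∣) (proj₂ ∣a∣)) (l (+ x) (+ y) (proj₁ ∣a∣) (proj₁ ∣b∣) a b)))
    where
    l : ∀ x y s r a b → y * (r * b) - x * (s * a) ≡ - (x * s) * a + y * r * b
    l = solve-∀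

-- A shift by at least m leaves the range from 0 to m - 1; negative k is reduced to positive k by
-- exchanging x and y.
residue-unique : ∀ {m x y} k → x ℕ.< m → y ℕ.< m → + x ≡ + y + k * + m → x ≡ y
residue-unique {m} {x} {y} (+ zero) x< y< eq = ℤ.+-injective (trans eq (trans (cong (_+_ (+ y)) (ℤ.*-zeroˡ (+ m))) (ℤ.+-identityʳ (+ y))))
residue-unique {m} {x} {y} (+ suc k) x< y< eq = contradiction x< (ℕ.≤⇒≯ (ℕ.≤-trans (ℕ.m≤m+n m (k ℕ.* m))
  (ℕ.≤-trans (ℕ.m≤n+m (suc k ℕ.* m) y) (ℕ.≤-reflexive (sym (ℤ.+-injective (trans eq (cong (_+_ (+ y)) (sym (ℤ.pos-* (suc k) m))))))))))
residue-unique {m} {x} {y} -[1+ k ] x< y< eq = sym (residue-unique (+ suc k) y< x<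
  (trans (l (+ y) (+ suc k) (+ m)) (cong (λ z → z + + suc k * + m) (sym eq))))
  where
  l : ∀ y k m → y ≡ y + - k * m + k * m
  l = solve-∀

split : ∀ z (m : ℕ) .{{_ : ℕ.NonZero m}} → ∃₂ λ (x : Fin m) q → z ≡ + toℕ x + q * + m
split z m = fromℕ< r<m , z /ℕ m , trans (ℤ.a≡a%ℕn+[a/ℕn]*n z m)
  (cong (λ r → + r + (z /ℕ m) * + m) (sym (Fin.toℕ-fromℕ< r<m)))
  where r<m = ℤ.n%ℕd<d z m

module Residues {F : Field} (π : O F) (π≢0 : ¬ π ≡ 0O) where
  open Quotient (ringO F) π
  open Bézout (bézout (re π) (im π))
  private
    t n a b : ℤ
    t = tr F
    n = nn F
    a = re π
    b = im π
    π′ η-coeff : O F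
    π′ = a′ ⊕ b′ θ
    -- The θ-coordinate of (p + u θ) π is p b + u a + u b t; p = w - u t makes it u a + w b = g, and
    -- `e` is the other coordinate.
    η-coeff = (w - u * t) ⊕ u θ
    e : ℤ
    e = (w - u * t) * a + u * b * n

  -- Hermite normal form: the lattice π O has basis h, e + g θ, hence index h g = N(π).
  h : ℕ
  h = ∥ π′ ∥ ℕ.* g

  +h : + h ≡ N π′ * + g
  +h = trans (ℤ.pos-* ∥ π′ ∥ g) (cong (_* + g) (+∥∥ π′))

  Nπ≡hg : N π ≡ + h * + g
  Nπ≡hg = trans (cong₂ (λ a b → a * a + t * a * b - n * b * b) a≡a′g b≡b′g)
    (trans (eq a′ b′ (+ g) t n) (cong (_* + g) (sym +h)))
    where
    eq : ∀ a b g t n → a * g * (a * g) + t * (a * g) * (b * g) - n * (b * g) * (b * g)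
      ≡ (a * a + t * a * b - n * b * b) * g * g
    eq = solve-∀

  ∥π∥≡hg : ∥ π ∥ ≡ h ℕ.* g
  ∥π∥≡hg = ℤ.+-injective (trans (+∥∥ π) (trans Nπ≡hg (sym (ℤ.pos-* h g))))

  instance
    hg≢0 : ℕ.NonZero (h ℕ.* g)
    hg≢0 = ℕ.>-nonZero (subst (ℕ._> 0) ∥π∥≡hg (∥∥>0 π≢0))
    h≢0 : ℕ.NonZero h
    h≢0 = ℕ.m*n≢0⇒m≢0 h {g}
    g≢0 : ℕ.NonZero g
    g≢0 = ℕ.m*n≢0⇒n≢0 h {g}

  h≡conj*π : (+ h) ⊕ + 0 θ ≡ conj π′ *O π
  h≡conj*π = trans (cong (_⊕ + 0 θ) +h) (sym (trans (cong₂ (λ a b → conj π′ *O (a ⊕ b θ)) a≡a′g b≡b′g)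
    (cong₂ _⊕_θ (re-eq a′ b′ (+ g) t n) (im-eq a′ b′ (+ g) t))))
    where
    re-eq : ∀ a b g t n → (a + t * b) * (a * g) + - b * (b * g) * n ≡ (a * a + t * a * b - n * b * b) * g
    re-eq = solve-∀
    im-eq : ∀ a b g t → (a + t * b) * (b * g) + - b * (a * g) + - b * (b * g) * t ≡ + 0
    im-eq = solve-∀

  e+gθ≡η*π : e ⊕ + g θ ≡ η-coeff *O π
  e+gθ≡η*π = cong (e ⊕_θ) (trans (sym ua+wb≡g) (eq a b u w t))
    where
    eq : ∀ a b u w t → u * a + w * b ≡ (w - u * t) * b + u * a + u * b * t
    eq = solve-∀

  residue : Fin h → Fin g → O F
  residue x y = (+ toℕ x) ⊕ + toℕ y θ

  lattice-multiple : ℤ → ℤ → O F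
  lattice-multiple q₁ q₂ = (q₁ ⊕ + 0 θ) *O η-coeff +O (q₂ ⊕ + 0 θ) *O conj π′

  lattice-multiple-*π : ∀ q₁ q₂ → lattice-multiple q₁ q₂ *O π ≡ (q₁ * e + q₂ * + h) ⊕ q₁ * + g θ
  lattice-multiple-*π q₁ q₂ = begin
    lattice-multiple q₁ q₂ *O π
      ≡⟨ distribʳ π ((q₁ ⊕ + 0 θ) *O η-coeff) ((q₂ ⊕ + 0 θ) *O conj π′) ⟩
    (q₁ ⊕ + 0 θ) *O η-coeff *O π +O (q₂ ⊕ + 0 θ) *O conj π′ *O π
      ≡⟨ cong₂ _+O_ (*O-assoc (q₁ ⊕ + 0 θ) η-coeff π) (*O-assoc (q₂ ⊕ + 0 θ) (conj π′) π) ⟩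
    (q₁ ⊕ + 0 θ) *O (η-coeff *O π) +O (q₂ ⊕ + 0 θ) *O (conj π′ *O π)
      ≡⟨ cong₂ (λ y z → (q₁ ⊕ + 0 θ) *O y +O (q₂ ⊕ + 0 θ) *O z) e+gθ≡η*π h≡conj*π ⟨
    (q₁ ⊕ + 0 θ) *O (e ⊕ + g θ) +O (q₂ ⊕ + 0 θ) *O ((+ h) ⊕ + 0 θ)
      ≡⟨ cong₂ _⊕_θ (re-eq q₁ q₂ e (+ g) (+ h) n) (im-eq q₁ q₂ e (+ g) (+ h) t) ⟩
    (q₁ * e + q₂ * + h) ⊕ q₁ * + g θ  ∎
    where
    open ≡.≡-Reasoning
    open CommutativeRing (ringO F) using (distribʳ)
    re-eq : ∀ q r e g h n → q * e + + 0 * g * n + (r * h + + 0 * + 0 * n) ≡ q * e + r * h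
    re-eq = solve-∀
    im-eq : ∀ q r e g h t → q * g + + 0 * e + + 0 * g * t + (r * + 0 + + 0 * h + + 0 * + 0 * t) ≡ q * g
    im-eq = solve-∀

  ≈-by-coordinates : ∀ {z} x y q₁ q₂ → re z ≡ x + (q₁ * e + q₂ * + h) → im z ≡ y + q₁ * + g → z ≈π x ⊕ y θ
  ≈-by-coordinates x y q₁ q₂ re≡ im≡ = lattice-multiple q₁ q₂ by
    trans (cong₂ _⊕_θ re≡ im≡) (cong ((x ⊕ y θ) +O_) (sym (lattice-multiple-*π q₁ q₂)))

  -- The θ-coordinate is reduced first, with e + g θ, which disturbs the other coordinate; that one
  -- is then reduced with h, which has no θ-part.
  residue-surjective : ∀ z → ∃₂ λ x y → z ≈π residue x y
  residue-surjective z =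
    let y , q₁ , im≡ = split (im z) g
        x , q₂ , re≡ = split (re z - q₁ * e) h
    in x , y , ≈-by-coordinates (+ toℕ x) (+ toℕ y) q₁ q₂ (shift (re z) (q₁ * e) (+ toℕ x) (q₂ * + h) re≡) im≡
    where
    shift : ∀ z w x r → z - w ≡ x + r → z ≡ x + (w + r)
    shift z w x r z-w≡x+r = trans (l₁ z w) (trans (cong (_+ w) z-w≡x+r) (l₂ x r w))
      where
      l₁ : ∀ z w → z ≡ z - w + w
      l₁ = solve-∀
      l₂ : ∀ x r w → x + r + w ≡ x + (w + r)
      l₂ = solve-∀

  -- From z = q π follows z π̄ = N(π) q, and u a + w b = g turns this into z g = N(π) (…).
  h∣integer-multiples : ∀ {z} q → z ⊕ + 0 θ ≡ q *O π → ∃ λ k → z ≡ k * + h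
  h∣integer-multiples {z} q@(q₀ ⊕ q₁ θ) z≡qπ = k , ℤ.*-cancelʳ-≡ z (k * + h) (+ g) {{g≢0}} (begin
    z * + g                                        ≡⟨ cong (z *_) ua+wb≡g ⟨
    z * (u * a + w * b)                            ≡⟨ l₁ z a b u w t n ⟩
    u * (z * (a + t * b) + + 0 * - b * n) + (u * t - w) * (z * - b + + 0 * (a + t * b) + + 0 * - b * t)
      ≡⟨ cong₂ (λ x y → u * x + (u * t - w) * y) (cong re z*conj) (cong im z*conj) ⟩
    u * (q₀ * N π + q₁ * + 0 * n) + (u * t - w) * (q₀ * + 0 + q₁ * N π + q₁ * + 0 * t)
                                                   ≡⟨ l₂ q₀ q₁ (N π) u w t n ⟩
    k * N π                                        ≡⟨ cong (k *_) Nπ≡hg ⟩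
    k * (+ h * + g)                                ≡⟨ ℤ.*-assoc k (+ h) (+ g) ⟨
    k * + h * + g                                  ∎)
    where
    open ≡.≡-Reasoning
    k = u * q₀ + (u * t - w) * q₁
    z*conj : (z ⊕ + 0 θ) *O conj π ≡ q *O (N π ⊕ + 0 θ)
    z*conj = trans (cong (_*O conj π) z≡qπ) (trans (*O-assoc q π (conj π)) (cong (q *O_) (*-conj π)))
    l₁ : ∀ z a b u w t n → z * (u * a + w * b) ≡
      u * (z * (a + t * b) + + 0 * - b * n) + (u * t - w) * (z * - b + + 0 * (a + t * b) + + 0 * - b * t)
    l₁ = solve-∀
    l₂ : ∀ q₀ q₁ N u w t n → u * (q₀ * N + q₁ * + 0 * n) + (u * t - w) * (q₀ * + 0 + q₁ * N + q₁ * + 0 * t)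
      ≡ (u * q₀ + (u * t - w) * q₁) * N
    l₂ = solve-∀

  -- θ-coordinates of multiples of π are divisible by g, which gives y = y′. The difference is then
  -- a rational integer divisible by π, hence by h.
  residue-injective : ∀ {x x′ y y′} → residue x y ≈π residue x′ y′ → x ≡ x′ × y ≡ y′
  residue-injective {x} {x′} {y} {y′} (q@(q₀ ⊕ q₁ θ) by eq) = Fin.toℕ-injective x≡x′ , Fin.toℕ-injective y≡y′
    where
    im-multiple : im (q *O π) ≡ (q₀ * b′ + q₁ * a′ + q₁ * b′ * t) * + g
    im-multiple = trans (cong₂ (λ a b → q₀ * b + q₁ * a + q₁ * b * t) a≡a′g b≡b′g) (l q₀ q₁ a′ b′ (+ g) t)
      where
      l : ∀ q₀ q₁ a b g t → q₀ * (b * g) + q₁ * (a * g) + q₁ * (b * g) * t ≡ (q₀ * b + q₁ * a + q₁ * b * t) * g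
      l = solve-∀
    y≡y′ : toℕ y ≡ toℕ y′
    y≡y′ = residue-unique (q₀ * b′ + q₁ * a′ + q₁ * b′ * t) (Fin.toℕ<n y) (Fin.toℕ<n y′)
      (trans (cong im eq) (cong (_+_ (+ toℕ y′)) im-multiple))
    im≡0 : im (q *O π) ≡ + 0
    im≡0 = ∙-cancelˡ (AbelianGroup.group ℤ.+-0-abelianGroup) (+ toℕ y′) _ _ (trans (sym (cong im eq)) (trans (cong +_ y≡y′) (sym (ℤ.+-identityʳ _))))
    integer : ∃ λ k → re (q *O π) ≡ k * + h
    integer = h∣integer-multiples q (cong (re (q *O π) ⊕_θ) (sym im≡0))
    x≡x′ : toℕ x ≡ toℕ x′
    x≡x′ = residue-unique (proj₁ integer) (Fin.toℕ<n x) (Fin.toℕ<n x′)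
      (trans (cong re eq) (cong (_+_ (+ toℕ x′)) (proj₂ integer)))

  open CommutativeRing quotientRing using (setoid)
  open Membership setoid using (_∈_)
  open Unique setoid using (Unique)

  residues : List (O F)
  residues = cartesianProductWith residue (allFin h) (allFin g)

  length-residues : length residues ≡ ∥ π ∥
  length-residues = trans (length-cartesianProductWith residue (allFin h) (allFin g))
    (trans (cong₂ ℕ._*_ (length-tabulate {n = h} (λ i → i)) (length-tabulate {n = g} (λ i → i))) (sym ∥π∥≡hg))

  residues! : Unique residues
  residues! = Uniqueₚ.cartesianProductWith⁺ (≡.setoid (Fin h)) (≡.setoid (Fin g)) setoid residue residue-injective
    (Unique-≡.allFin⁺ h) (Unique-≡.allFin⁺ g)

  ∈-residues : ∀ z → z ∈ residues
  ∈-residues z = let x , y , z≈ = residue-surjective z in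
    Membershipₚ.∈-resp-≈ setoid (≈π-sym z≈)
      (Membershipₚ.∈-cartesianProductWith⁺ (≡.setoid (Fin h)) (≡.setoid (Fin g)) setoid
        (λ { refl refl → ≈⇒≈π refl }) (∈ₚ.∈-allFin x) (∈ₚ.∈-allFin y))

_≟O_ : ∀ {F} → Decidable {A = O F} _≡_
x ≟O y = map′ (λ (p , q) → cong₂ _⊕_θ p q) (λ x≡y → cong re x≡y , cong im x≡y)
  (re x ℤ.≟ re y ×-dec im x ℤ.≟ im y)

∥-1∥ : ∀ {F} → ∥ -O (1O {F}) ∥ ≡ 1
∥-1∥ {F} = trans (cong ∣_∣ (N-neg {F} 1O)) (unit⇒∥∥≡1 {F} 1O (1O , *O-identityˡ 1O))

-- The residue field of an irreducible element

module ResidueField {F : Field} (π : O F) (π-irreducible : Irreducible π) where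
  open Quotient (ringO F) π public

  private
    π≢0 : ¬ π ≡ 0O
    π≢0 = proj₁ π-irreducible
    module R = CommutativeRing (ringO F)
    module Q = CommutativeRing quotientRing

  open Residues π π≢0 public

  2≤∥π∥ : 2 ℕ.≤ ∥ π ∥
  2≤∥π∥ = ℕ.≤∧≢⇒< (∥∥>0 π≢0) λ 1≡n → proj₁ (proj₂ π-irreducible) (∥∥≡1⇒unit π (sym 1≡n))

  π≈0 : π ≈π 0O
  π≈0 = 1O by sym (trans (R.+-identityˡ (1O *O π)) (R.*-identityˡ π))

  *π+≈ : ∀ {x} q r → x ≡ q *O π +O r → x ≈π r
  *π+≈ q r eq = q by trans eq (R.+-comm (q *O π) r)

  -- Norms are multiplicative, so a nonzero multiple of π has norm at least N(π).
  small≈0⇒≡0 : ∀ {x} → ∥ x ∥ < ∥ π ∥ → x ≈π 0O → x ≡ 0O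
  small≈0⇒≡0 {x} x<π (q by x≡) = by-norm ∥ q ∥ refl
    where
    open ℕ.≤-Reasoning
    x≡qπ : x ≡ q *O π
    x≡qπ = trans x≡ (R.+-identityˡ (q *O π))
    by-norm : ∀ m → ∥ q ∥ ≡ m → x ≡ 0O
    by-norm zero    ∥q∥≡0 = trans x≡qπ (trans (cong (_*O π) (∥∥≡0 {x = q} ∥q∥≡0)) (R.zeroˡ π))
    by-norm (suc m) ∥q∥≡1+m = contradiction x<π (ℕ.≤⇒≯ (begin
      ∥ π ∥             ≤⟨ ℕ.m≤m+n ∥ π ∥ (m ℕ.* ∥ π ∥) ⟩
      suc m ℕ.* ∥ π ∥   ≡⟨ cong (ℕ._* ∥ π ∥) ∥q∥≡1+m ⟨
      ∥ q ∥ ℕ.* ∥ π ∥   ≡⟨ ∥∥-* q π ⟨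
      ∥ q *O π ∥        ≡⟨ cong ∥_∥ x≡qπ ⟨
      ∥ x ∥             ∎))

  remainder : ∀ x → ∃ λ r → ∥ r ∥ < ∥ π ∥ × x ≈π r
  remainder x = let q , r , x≡ , r<π = euclid x π≢0 in r , r<π , *π+≈ q r x≡

  1≉0 : ¬ 1O ≈π 0O
  1≉0 1≈0 = contradiction (cong re (small≈0⇒≡0 1<π 1≈0)) λ ()
    where
    1<π : ∥ 1O {F} ∥ < ∥ π ∥
    1<π = subst (_< ∥ π ∥) (sym (unit⇒∥∥≡1 {F} 1O (1O , *O-identityˡ 1O))) 2≤∥π∥

  _≟0 : ∀ x → Dec (x ≈π 0O)
  x ≟0 = let r , r<π , x≈r = remainder x in
    map′ (λ r≡0 → Q.trans x≈r (≈⇒≈π r≡0)) (λ x≈0 → small≈0⇒≡0 r<π (Q.trans (Q.sym x≈r) x≈0)) (r ≟O 0O)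

  _≟π_ : Decidable _≈π_
  x ≟π y = map′ (x∙y⁻¹≈ε⇒x≈y x y) x≈y⇒x∙y⁻¹≈ε ((x -O y) ≟0)
    where open import Algebra.Properties.Group Q.+-group using (x∙y⁻¹≈ε⇒x≈y; x≈y⇒x∙y⁻¹≈ε)

  -- Irreducibility makes one factor a unit; if it were γ, then ω and π would have equal norms.
  small-divisor-unit : ∀ γ ω → ∥ ω ∥ < ∥ π ∥ → π ≡ γ *O ω → IsUnit ω
  small-divisor-unit γ ω ω<π π≡γω = by-cases (proj₂ (proj₂ π-irreducible) γ ω π≡γω)
    where
    open ≡.≡-Reasoning
    by-cases : IsUnit γ ⊎ IsUnit ω → IsUnit ω
    by-cases (inj₂ unit-ω) = unit-ω
    by-cases (inj₁ unit-γ) = contradiction ω<π (ℕ.≤⇒≯ (ℕ.≤-reflexive (begin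
      ∥ π ∥              ≡⟨ cong ∥_∥ π≡γω ⟩
      ∥ γ *O ω ∥         ≡⟨ ∥∥-* γ ω ⟩
      ∥ γ ∥ ℕ.* ∥ ω ∥    ≡⟨ cong (ℕ._* ∥ ω ∥) (unit⇒∥∥≡1 γ unit-γ) ⟩
      1 ℕ.* ∥ ω ∥        ≡⟨ ℕ.*-identityˡ ∥ ω ∥ ⟩
      ∥ ω ∥              ∎)))

  γω≈-ρ : ∀ γ ω ρ → π ≡ γ *O ω +O ρ → γ *O ω ≈π -O ρ
  γω≈-ρ γ ω ρ π≡ = inverseˡ-unique (γ *O ω) ρ (Q.trans (≈⇒≈π (sym π≡)) π≈0)
    where open import Algebra.Properties.Group Q.+-group using (inverseˡ-unique)

  -- If γ vanished modulo π, so would ρ, which is too small for that. The descent needs this to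
  -- cancel γ and to continue with it.
  cofactor≉0 : ∀ γ ω ρ → π ≡ γ *O ω +O ρ → ∥ ρ ∥ < ∥ π ∥ → ¬ ρ ≡ 0O → ¬ γ ≈π 0O
  cofactor≉0 γ ω ρ π≡ ρ<π ρ≢0 γ≈0 = ρ≢0 (small≈0⇒≡0 ρ<π (begin
    ρ             ≈⟨ Q.+-identityˡ ρ ⟨
    0O +O ρ       ≈⟨ Q.+-congʳ {ρ} (Q.trans (Q.*-congʳ {ω} γ≈0) (Q.zeroˡ ω)) ⟨
    γ *O ω +O ρ   ≈⟨ ≈⇒≈π π≡ ⟨
    π             ≈⟨ π≈0 ⟩
    0O            ∎))
    where open import Relation.Binary.Reasoning.Setoid Q.setoid

  -- If π = γ x + ρ with ρ ≠ 0, then x has inverse - v γ, where v is the inverse of the smaller ρ.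
  small-inverse : ∀ x → Acc _<_ ∥ x ∥ → ∥ x ∥ < ∥ π ∥ → ¬ x ≡ 0O → ∃ λ y → y *O x ≈π 1O
  small-inverse x (acc rec) x<π x≢0 =
    let γ , ρ , π≡ , ρ<x = euclid π x≢0 in by-cases γ ρ π≡ ρ<x (ρ ≟O 0O)
    where
    open import Relation.Binary.Reasoning.Setoid Q.setoid
    open import Algebra.Properties.Ring R.ring using (-‿distribˡ-*)
    open import Algebra.Properties.Group R.+-group using (⁻¹-involutive)
    by-cases : ∀ γ ρ → π ≡ γ *O x +O ρ → ∥ ρ ∥ < ∥ x ∥ → Dec (ρ ≡ 0O) → ∃ λ y → y *O x ≈π 1O
    by-cases γ ρ π≡ ρ<x (yes refl) =
      let v , xv≡1 = small-divisor-unit γ x x<π (trans π≡ (R.+-identityʳ (γ *O x)))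
      in v , ≈⇒≈π (trans (R.*-comm v x) xv≡1)
    by-cases γ ρ π≡ ρ<x (no ρ≢0) =
      let v , vρ≈1 = small-inverse ρ (rec ρ<x) (ℕ.<-trans ρ<x x<π) ρ≢0
      in v *O (-O γ) , (begin
        v *O (-O γ) *O x       ≈⟨ Q.*-assoc v (-O γ) x ⟩
        v *O ((-O γ) *O x)     ≈⟨ Q.*-congˡ {v} (≈⇒≈π (-‿distribˡ-* γ x)) ⟨
        v *O (-O (γ *O x))     ≈⟨ Q.*-congˡ {v} (Q.-‿cong (γω≈-ρ γ x ρ π≡)) ⟩
        v *O (-O (-O ρ))       ≈⟨ Q.*-congˡ {v} (≈⇒≈π (⁻¹-involutive ρ)) ⟩
        v *O ρ                 ≈⟨ vρ≈1 ⟩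
        1O                     ∎)

  inverse : ∀ x → ¬ x ≈π 0O → ∃ λ y → y *O x ≈π 1O
  inverse x x≉0 =
    let r , r<π , x≈r = remainder x
        y , yr≈1 = small-inverse r (<-wellFounded ∥ r ∥) r<π (λ r≡0 → x≉0 (Q.trans x≈r (≈⇒≈π r≡0)))
    in y , Q.trans (Q.*-congˡ {y} x≈r) yr≈1

  open FiniteField quotientRing _≟π_ 1≉0 inverse residues residues! ∈-residues public

  open import Algebra.Properties.Semiring.Exp Q.semiring using (_^_)

  ^O≡^ : ∀ x k → x ^O k ≡ x ^ k
  ^O≡^ x zero    = refl
  ^O≡^ x (suc k) = cong (x *O_) (^O≡^ x k)

  private
    -O≡⇒≡+O : ∀ {x y z} → x -O y ≡ z → x ≡ y +O z
    -O≡⇒≡+O {x} {y} {z} x-y≡z = trans (sym (//-rightDividesˡ y x)) (trans (cong (_+O y) x-y≡z) (R.+-comm z y))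
      where open import Algebra.Properties.Group R.+-group using (//-rightDividesˡ)

  nonPower⇒NonResidue : ∀ {k ω} → ¬ ω ≈π 0O → ¬ IsPower k ω → NonResidue k π ω
  nonPower⇒NonResidue {k} {ω} ω≉0 ω∉ =
    (λ (q , ω≡) → ω≉0 (q by trans ω≡ (sym (R.+-identityˡ (q *O π))))) ,
    (λ (x , q , eq) → ω∉ (x , (q by -O≡⇒≡+O (trans (cong (_-O ω) (sym (^O≡^ x k))) eq))))

  -- Descent to a small non-residue

  module _ (k : ℕ) (k>0 : k > 0) where

    record SmallNonPower : Set where
      constructor small
      field
        {ω}        : O F
        ω≉0        : ¬ ω ≈π 0O
        ω∉         : ¬ IsPower k ω
        bound      : AbsBound ω π

    -- For π = γ ω + ρ one of -1, ρ, γ is a non-power: otherwise so is ω, as γ ω ≈ - ρ.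
    -- If it is γ and γ is not smaller than ω, then ω is small.
    descend : ∀ ω → Acc _<_ ∥ ω ∥ → ∥ ω ∥ < ∥ π ∥ → ¬ ω ≈π 0O → ¬ IsPower k ω → SmallNonPower
    descend ω (acc rec) ω<π ω≉0 ω∉ =
      let γ , ρ , π≡ , ρ<ω = euclid π (λ ω≡0 → ω≉0 (≈⇒≈π ω≡0)) in step γ ρ π≡ ρ<ω (ρ ≟O 0O)
      where
      step : ∀ γ ρ → π ≡ γ *O ω +O ρ → ∥ ρ ∥ < ∥ ω ∥ → Dec (ρ ≡ 0O) → SmallNonPower
      -- Now ω divides π and is smaller, so it is a unit and has norm 1.
      step γ ρ π≡ ρ<ω (yes refl) =
        small ω≉0 ω∉ (absBound-small ω π 2≤∥π∥ (ℕ.≤-trans (ℕ.≤-reflexive ∥ω∥≡1) (s≤s z≤n)))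
        where
        ∥ω∥≡1 : ∥ ω ∥ ≡ 1
        ∥ω∥≡1 = unit⇒∥∥≡1 ω (small-divisor-unit γ ω ω<π (trans π≡ (R.+-identityʳ (γ *O ω))))
      step γ ρ π≡ ρ<ω (no ρ≢0) = by-cases (isPower? k ρ) (isPower? k (-O 1O)) (isPower? k γ) (∥ γ ∥ ℕ.<? ∥ ω ∥)
        where
        open import Algebra.Properties.Group Q.+-group using (⁻¹-injective; ε⁻¹≈ε)
        open import Algebra.Properties.Ring Q.ring using (-1*x≈-x)
        ρ<π : ∥ ρ ∥ < ∥ π ∥
        ρ<π = ℕ.<-trans ρ<ω ω<π
        γ≉0 : ¬ γ ≈π 0O
        γ≉0 = cofactor≉0 γ ω ρ π≡ ρ<π ρ≢0
        -1≉0 : ¬ (-O 1O) ≈π 0O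
        -1≉0 -1≈0 = 1≉0 (⁻¹-injective (Q.trans -1≈0 (Q.sym ε⁻¹≈ε)))
        -ρ≈ωγ : (-O 1O) *O ρ ≈π ω *O γ
        -ρ≈ωγ = Q.trans (-1*x≈-x ρ) (Q.trans (Q.sym (γω≈-ρ γ ω ρ π≡)) (Q.*-comm γ ω))
        by-cases : Dec (IsPower k ρ) → Dec (IsPower k (-O 1O)) → Dec (IsPower k γ) → Dec (∥ γ ∥ < ∥ ω ∥) → SmallNonPower
        by-cases (no ρ∉) _ _ _ = descend ρ (rec ρ<ω) ρ<π (λ ρ≈0 → ρ≢0 (small≈0⇒≡0 ρ<π ρ≈0)) ρ∉
        by-cases (yes _) (no -1∉) _ _ =
          small -1≉0 -1∉ (absBound-small (-O 1O) π 2≤∥π∥ (ℕ.≤-trans (ℕ.≤-reflexive (∥-1∥ {F})) (s≤s z≤n)))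
        by-cases (yes ρ∈) (yes -1∈) (yes γ∈) _ =
          contradiction (IsPower-cancelʳ {k} {ω} {γ} k>0 γ≉0 (IsPower-resp-≈ {k} -ρ≈ωγ (IsPower-* {k} -1∈ ρ∈)) γ∈) ω∉
        by-cases (yes _) (yes _) (no γ∉) (yes γ<ω) = descend γ (rec γ<ω) (ℕ.<-trans γ<ω ω<π) γ≉0 γ∉
        by-cases (yes _) (yes _) (no γ∉) (no γ≮ω) =
          small ω≉0 ω∉ (absBound ω π γ ρ 2≤∥π∥ π≡ ρ<ω (ℕ.≮⇒≥ γ≮ω))

    -- The descent has to start below N(π), so that any divisor of π met on the way is a unit;
    -- passing to a congruent element preserves being a nonzero non-power.
    descend-from-remainder : ∀ x → ¬ x ≈π 0O → ¬ IsPower k x → (∃ λ r → ∥ r ∥ < ∥ π ∥ × x ≈π r) → SmallNonPower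
    descend-from-remainder x x≉0 x∉ (r , r<π , x≈r) = descend r (<-wellFounded ∥ r ∥) r<π
      (λ r≈0 → x≉0 (Q.trans x≈r r≈0))
      (λ r∈ → x∉ (IsPower-resp-≈ {k} {r} {x} (Q.sym x≈r) r∈))

    ∃-smallNonPower : gcd k (∥ π ∥ ℕ.∸ 1) > 1 → SmallNonPower
    ∃-smallNonPower gcd>1 = from-nonPower (∃-nonPower k k>0 (subst (λ n → gcd k (n ℕ.∸ 1) > 1) (sym length-residues) gcd>1))
      where
      from-nonPower : (∃ λ x → ¬ x ≈π 0O × ¬ IsPower k x) → SmallNonPower
      from-nonPower (x , x≉0 , x∉) = descend-from-remainder x x≉0 x∉ (remainder x)

∣N-1∣ : ∀ {F} (π : O F) → 0 < ∥ π ∥ → ∣ N π - + 1 ∣ ≡ ∥ π ∥ ℕ.∸ 1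
∣N-1∣ π 0<n = trans (cong (λ z → ∣ z - + 1 ∣) (sym (+∥∥ π))) (lemma ∥ π ∥ 0<n)
  where
  lemma : ∀ n → 0 < n → ∣ + n - + 1 ∣ ≡ n ℕ.∸ 1
  lemma (suc n) _ = refl

theorem2 : (F : Field) (π : O F) → Irreducible π →
    (k : ℕ) → k > 0 → gcd k ∣ N π - + 1 ∣ > 1 →
    ∃ λ (ω : O F) → NonResidue k π ω × AbsBound ω π
theorem2 F π π-irreducible k k>0 gcd>1 =
  let small ω≉0 ω∉ bound = ∃-smallNonPower k k>0 (subst (λ n → gcd k n > 1) (∣N-1∣ π (ℕ.<⇒≤ 2≤∥π∥)) gcd>1)
  in _ , nonPower⇒NonResidue {k} ω≉0 ω∉ , bound
  where open ResidueField π π-irreducible
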